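{- Fix $m\ge 2$. Assume that for all parameters $(s,c,k)$ an $m$-wise merger $\mathrm{mw\_merge}^s_{(c,k)}$ of order $(c,k)$ on $s$ inputs (over $X\cup\{\bot\}$) is given. Define recursively, for $1\le k\le n$, the generalized comparator network $\mathrm{mw\_sel}^n_k$ on input $\bar x\in X^n$ as follows. If $k=1$: output $\max^n(\bar x)$. If $k\ge 2$: choose integers $n_1\ge\dots\ge n_m\ge 0$ with $\sum_i n_i=n$ and $n_1<n$. Let $\bar x^1$ be the first $n_1$ elements of $\bar x$, $\bar x^2$ the next $n_2$ elements, and so on. For each row $1\le j\le n_1$ let $m'_j=\max\{i:n_i\ge j\}$ and let $\bar y^j=\mathrm{sort}^{m'_j}(\langle x^1_j,\dots,x^{m'_j}_j\rangle)$. For each $1\le i\le m$ let $k_i=\min(n_1,\lfloor k/i\rfloor)$, $l_i=\min(n_i,\lfloor k/i\rfloor)$ (so $k_i\ge l_i$), let $\bar t^i=\langle y^1_i,\dots,y^{n_i}_i\rangle$ and $\bar z^i=\mathrm{mw\_sel}^{n_i}_{l_i}(\bar t^i)$ (with $\bar z^i=\bar t^i$ if $l_i=0$). Let $s=\sum_i k_i$, $c=k_1$, $\overline{out}=\mathrm{suff}(l_1+1,\bar z^1)::\dots::\mathrm{suff}(l_m+1,\bar z^m)$, and $\overline{res}=\mathrm{mw\_merge}^s_{(c,k)}(\langle \mathrm{pref}(l_1,\bar z^1)::\bot^{k_1-l_1},\dots,\mathrm{pref}(l_m,\bar z^m)::\bot^{k_m-l_m}\rangle)$. Output $\mathrm{drop}(\bot,\overline{res})::\overline{out}$.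 Then for every choice of the splittings, $\mathrm{mw\_sel}^n_k$ is a $k$-selection network, i.e. for every $\bar x\in X^n$ the output $\mathrm{mw\_sel}^n_k(\bar x)$ is top $k$ sorted.
   Context: $X$ is a totally ordered set; $\bot\notin X$ is an auxiliary element with $\bot<x$ for all $x\in X$. A sequence is sorted if it is non-increasing. For $\bar x=\langle x_1,\dots,x_n\rangle$: $\bar x::\bar y$ is concatenation; $\mathrm{pref}(i,\bar x)=\langle x_1,\dots,x_i\rangle$, $\mathrm{suff}(i,\bar x)=\langle x_i,\dots,x_n\rangle$ (empty if $i>n$); $\bot^r$ is the sequence of $r$ copies of $\bot$; $\mathrm{drop}(b,\bar x)$ removes all occurrences of $b$ from $\bar x$. $\mathrm{sort}^p$ rearranges $p$ values into non-increasing order (a $p$-sorter). A (generalized) comparator network is a map on sequences obtained by composing sorters applied to chosen positions and fixed rearrangements of positions; in particular it permutes its input. $\max^n$ denotes a comparator network on $n$ inputs whose first output is the maximum of its inputs. A sequence $\bar x\in X^n$ is top $k$ sorted ($k\le n$) if $\langle x_1,\dots,x_k\rangle$ is sorted and $x_i\ge x_j$ for all $i\le k<j$. A $k$-selection network on $n$ inputs is a comparator network whose output is top $k$ sorted for every input. $m$-wise tuple: let $c,k,m\in\mathbb{N}$, $1\le k$, $k/m\le c$, $k_i=\min(c,\lfloor k/i\rfloor)$; a tuple $\langle\bar x^1,\dots,\bar x^m\rangle$ with $\bar x^i$ of length $k_i$ is $m$-wise of order $(c,k)$ if every $\bar x^i$ is sorted and $x^i_j\ge x^{i+1}_j$ for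 all $1\le i<m$, $1\le j\le|\bar x^{i+1}|$. An $m$-wise merger of order $(c,k)$ on $s$ inputs is a comparator network $f$ such that for every $m$-wise tuple $T=\langle\bar x^1,\dots,\bar x^m\rangle$ of order $(c,k)$ with $\sum_i|\bar x^i|=s$, $f(\bar x^1::\dots::\bar x^m)$ is top $k$ sorted. -}

module Defs where

open import Algebra.Properties.CommutativeMonoid.Sum using (sum)
open import Data.Bool.Base using (Bool; true; false)
open import Data.Fin.Base as Fin using (Fin; zero; suc; toℕ; fromℕ<; inject≤)
open import Data.Fin.Permutation using (Permutation; Permutation′; _⟨$⟩ˡ_; flip)
open import Data.Fin.Properties using (toℕ<n; toℕ-inject≤)
open import Data.List.Base as List using (List; length; catMaybes; filter; allFin)
open import Data.List.Extrema.Nat using (max; argmax-sel; xs≤max; max≤v⁺)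
open import Data.List.Membership.Propositional.Properties using (∈-map⁺; ∈-map⁻; ∈-filter⁺; ∈-filter⁻; ∈-allFin)
open import Data.List.Properties using (length-take)
open import Data.List.Relation.Binary.Permutation.Propositional.Properties using (↭-length)
open import Data.List.Relation.Unary.All as All using ()
open import Data.Nat.Base using (ℕ; zero; suc; 2+; _+_; _⊓_; _/_; _≤_; _<_; z≤n; s≤s⁻¹; NonTrivial)
open import Data.Nat.Properties using (≤-trans; ≤-reflexive; m⊓n≤m; ⊓-monoˡ-≤; _<?_; +-0-commutativeMonoid)
open import Data.Product.Base using (_×_; _,_; ∃; proj₂)
open import Data.Sum.Base using (inj₁; inj₂; [_,_]′)
open import Data.Vec.Base as Vec using (Vec; []; _++_; take; drop; lookup; tabulate; toList; fromList; cast; padRight)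
open import Data.Vec.Membership.Propositional using (_∈_)
open import Data.Vec.Properties using (length-toList)
open import Data.Vec.Relation.Unary.All as VecAll using ()
open import Function.Base using (_∘_; const; case_of_)
open import Level using (Level; _⊔_)
open import Relation.Binary.Bundles using (DecTotalOrder)
open import Relation.Binary.Consequences using (total∧dec⇒dec)
open import Relation.Binary.Core using (Rel)
open import Relation.Binary.Definitions using (DecidableEquality)
open import Relation.Binary.PropositionalEquality.Core using (_≡_; refl; sym; trans; subst)
open import Relation.Binary.Structures using (IsTotalOrder)
open import Relation.Nullary.Construct.Add.Infimum using (_₋; ⊥₋; [_])
open import Relation.Nullary.Decidable.Core using (yes; no)
import Data.List.Relation.Unary.Sorted.TotalOrder as SortedTO
import Data.List.Sort as Sort
import Relation.Binary.Construct.Add.Infimum.NonStrict as AddInfimum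
import Relation.Binary.Construct.Flip.EqAndOrd as Flip

private
  variable
    a ℓ : Level

∑ : ∀ {m} → (Fin m → ℕ) → ℕ
∑ = sum +-0-commutativeMonoid

-- Indices are 0-based throughout: index i here is i + 1 in 1-based notation.

joinBlocks : ∀ {A : Set a} {m} (ns : Fin m → ℕ) → (∀ i → Vec A (ns i)) → Vec A (∑ ns)
joinBlocks {m = zero}  ns xs = []
joinBlocks {m = suc m} ns xs = xs zero ++ joinBlocks (ns ∘ suc) (xs ∘ suc)

block : ∀ {A : Set a} {m} (ns : Fin m → ℕ) → Vec A (∑ ns) → ∀ i → Vec A (ns i)
block ns xs zero    = take (ns zero) xs
block ns xs (suc i) = block (ns ∘ suc) (drop (ns zero) xs) i

-- min(c, ⌊k/i⌋) for 1-based i.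
width : ∀ {m} → ℕ → ℕ → Fin m → ℕ
width c k i = c ⊓ (k / suc (toℕ i))

permute : ∀ {A : Set a} {n n′} → Permutation n n′ → Vec A n → Vec A n′
permute π xs = tabulate (λ i → lookup xs (π ⟨$⟩ˡ i))

-- sorter p q π applies a p-sorter to the p positions that π sends to
-- 0 , … , p - 1 (the largest value goes to the position sent to 0) and keeps
-- the other q positions unchanged.
data Network (n : ℕ) : Set where
  rearrange : Permutation′ n → Network n
  sorter    : ∀ p q → Permutation n (p + q) → Network n
  _⨾_       : Network n → Network n → Network n

module Ordered {A : Set a} {_≤ᴬ_ : Rel A ℓ} (O : IsTotalOrder _≡_ _≤ᴬ_) where
  open IsTotalOrder O using (total; antisym; reflexive)

  private
    side : A → A → Bool
    side x y = [ const true , const false ]′ (total x y)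

    side-sym : ∀ {x y} → x ≡ y → side x y ≡ side y x
    side-sym refl = refl

  -- Decidability need not be assumed: the choices made by `total` at (x , y)
  -- and at (y , x) are the same exactly when x ≡ y.
  total⇒≟ : DecidableEquality A
  total⇒≟ x y with total x y | total y x | side-sym {x} {y}
  ... | inj₁ x≤y | inj₁ y≤x | _ = yes (antisym x≤y y≤x)
  ... | inj₂ y≤x | inj₂ x≤y | _ = yes (antisym x≤y y≤x)
  ... | inj₁ _   | inj₂ _   | s = no λ x≡y → case s x≡y of λ ()
  ... | inj₂ _   | inj₁ _   | s = no λ x≡y → case s x≡y of λ ()

  ≥-decTotalOrder : DecTotalOrder a a ℓ
  ≥-decTotalOrder = Flip.decTotalOrder record
    { isDecTotalOrder = record
      { isTotalOrder = O
      ; _≟_          = total⇒≟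
      ; _≤?_         = total∧dec⇒dec reflexive antisym total total⇒≟
      }
    }

  -- Both with respect to the reversed order, i.e. non-increasing.
  open Sort ≥-decTotalOrder public using (sort; sort-↭; sort-↗)
  open SortedTO (DecTotalOrder.totalOrder ≥-decTotalOrder) public using (Sorted)

  sortᵛ : ∀ {p} → Vec A p → Vec A p
  sortᵛ xs = cast (trans (↭-length (sort-↭ (toList xs))) (length-toList xs))
                  (fromList (sort (toList xs)))

  ⟦_⟧ : ∀ {n} → Network n → Vec A n → Vec A n
  ⟦ rearrange π  ⟧ xs = permute π xs
  ⟦ sorter p q π ⟧ xs = permute (flip π) (sortᵛ (take p ys) ++ drop p ys)
    where ys = permute π xs
  ⟦ N ⨾ N′       ⟧ xs = ⟦ N′ ⟧ (⟦ N ⟧ xs)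

  TopSorted : ℕ → List A → Set (a ⊔ ℓ)
  TopSorted k xs =
    k ≤ length xs ×
    Sorted (List.take k xs) ×
    (∀ i j → toℕ i < k → k ≤ toℕ j → List.lookup xs j ≤ᴬ List.lookup xs i)

  IsComparatorNetwork : ∀ {n} → (Vec A n → List A) → Set a
  IsComparatorNetwork {n} f = ∃ λ (N : Network n) → ∀ xs → f xs ≡ toList (⟦ N ⟧ xs)

  IsSelectionNetwork : ∀ {n} → ℕ → (Vec A n → List A) → Set (a ⊔ ℓ)
  IsSelectionNetwork k f = IsComparatorNetwork f × (∀ xs → TopSorted k (f xs))

  -- No condition when n is 0, as there is then no first output.
  IsMaxNetwork : ∀ {n} → Network n → Set (a ⊔ ℓ)
  IsMaxNetwork {n} N = ∀ (xs : Vec A n) (i : Fin n) → toℕ i ≡ 0 →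
    let y = lookup (⟦ N ⟧ xs) i in y ∈ xs × VecAll.All (_≤ᴬ y) xs

  record IsMWise {m} (c k : ℕ) (xs : (i : Fin m) → Vec A (width c k i)) : Set (a ⊔ ℓ) where
    field
      sorted    : ∀ i → Sorted (toList (xs i))
      -- p and q are the same index j, in the lengths of xs i′ and xs i.
      dominates : ∀ i i′ → toℕ i′ ≡ suc (toℕ i) →
                  ∀ p q → toℕ p ≡ toℕ q → lookup (xs i′) p ≤ᴬ lookup (xs i) q

  IsMerger : ∀ {s} → ℕ → ℕ → ℕ → Network s → Set (a ⊔ ℓ)
  IsMerger {s} m c k N =
    (xs : (i : Fin m) → Vec A (width c k i)) → IsMWise c k xs →
    (eq : ∑ {m} (width c k) ≡ s) →
    TopSorted k (toList (⟦ N ⟧ (cast eq (joinBlocks (width c k) xs))))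

first : ∀ m .{{_ : NonTrivial m}} → Fin m
first (2+ _) = zero

module _ (m : ℕ) .{{_ : NonTrivial m}} where

  Antitone : (Fin m → ℕ) → Set
  Antitone ns = ∀ {i j} → i Fin.≤ j → ns j ≤ ns i

  -- All the choices made when unfolding the recursion for n inputs and
  -- parameter k, each recursive call being free to choose its own splitting.
  -- The leaf for k = 0 stands for the columns that are passed on unchanged.
  data Splits : ℕ → ℕ → Set where
    unchanged : ∀ {n} → Splits n 0
    maximum   : ∀ {n} → Splits n 1
    split     : ∀ {k} → 2 ≤ k → (ns : Fin m → ℕ) → Antitone ns → ns (first m) < ∑ ns →
                (∀ i → Splits (ns i) (width (ns i) k i)) → Splits (∑ ns) k

first-≤ : ∀ m .{{_ : NonTrivial m}} (i : Fin m) → first m Fin.≤ i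
first-≤ (2+ _) _ = z≤n

module Rows {m} (ns : Fin m → ℕ) where

  reaching : ℕ → List ℕ
  reaching j = List.map (suc ∘ toℕ) (filter (λ i → j <? ns i) (allFin m))

  -- m′ⱼ = max { i : nᵢ ≥ j } (i and j 1-based), and 0 for rows past the end.
  rowLength : ℕ → ℕ
  rowLength j = max 0 (reaching j)

  rowLength≤m : ∀ j → rowLength j ≤ m
  rowLength≤m j = max≤v⁺ {xs = reaching j} z≤n (All.tabulate λ x∈ → case ∈-map⁻ (suc ∘ toℕ) x∈ of λ where
    (i , _ , x≡1+i) → subst (_≤ m) (sym x≡1+i) (toℕ<n i))

  <rowLength⁺ : ∀ {j} i → j < ns i → toℕ i < rowLength j
  <rowLength⁺ {j} i j<nᵢ = All.lookup (xs≤max 0 (reaching j))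
    (∈-map⁺ (suc ∘ toℕ) (∈-filter⁺ (λ i → j <? ns i) (∈-allFin i) j<nᵢ))

  <rowLength⁻ : (∀ {i j} → i Fin.≤ j → ns j ≤ ns i) →
                ∀ {j} i → toℕ i < rowLength j → j < ns i
  <rowLength⁻ anti {j} i i<m′ with argmax-sel (λ x → x) 0 (reaching j)
  ... | inj₁ m′≡0 = case subst (toℕ i <_) m′≡0 i<m′ of λ ()
  ... | inj₂ m′∈  with ∈-map⁻ (suc ∘ toℕ) m′∈
  ...   | i′ , i′∈ , m′≡1+i′ = ≤-trans
    (proj₂ (∈-filter⁻ (λ i → j <? ns i) {xs = allFin m} i′∈))
    (anti (s≤s⁻¹ (subst (toℕ i <_) m′≡1+i′ i<m′)))

withBottom : {X : Set a} {_≤ˣ_ : Rel X ℓ} → IsTotalOrder _≡_ _≤ˣ_ →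
             IsTotalOrder _≡_ (AddInfimum._≤₋_ _≤ˣ_)
withBottom {_≤ˣ_ = _≤ˣ_} = AddInfimum.≤₋-isTotalOrder-≡ _≤ˣ_

module Selection
  {X : Set a} {_≤ˣ_ : Rel X ℓ} (O : IsTotalOrder _≡_ _≤ˣ_)
  (m : ℕ) .{{_ : NonTrivial m}}
  (maxNet : ∀ n → Network n) (mw-merge : ∀ s (c k : ℕ) → Network s)
  where

  private
    module X  = Ordered O
    module X₋ = Ordered (withBottom O)

  module Columns (ns : Fin m → ℕ) (anti : Antitone m ns) (xs : Vec X (∑ ns)) where
    open Rows ns

    row : ∀ j → Vec X (rowLength j)
    row j = tabulate λ i →
      let i′ = inject≤ i (rowLength≤m j)
      in lookup (block ns xs i′)
           (fromℕ< (<rowLength⁻ anti i′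
             (subst (_< rowLength j) (sym (toℕ-inject≤ i (rowLength≤m j))) (toℕ<n i))))

    column : ∀ i → Vec X (ns i)
    column i = tabulate λ j →
      lookup (X.sortᵛ (row (toℕ j))) (fromℕ< (<rowLength⁺ i (toℕ<n j)))

  -- pref(l, z) followed by r - l copies of ⊥, when z has at least l elements.
  padPrefix : ∀ {l r} → l ≤ r → List X → Vec (X ₋) r
  padPrefix {l} l≤r zs = padRight
    (≤-trans (≤-trans (≤-reflexive (length-take l zs)) (m⊓n≤m l (length zs))) l≤r)
    ⊥₋ (Vec.map [_] (fromList (List.take l zs)))

  module Merge (k : ℕ) (ns : Fin m → ℕ) (anti : Antitone m ns) (z : Fin m → List X) where

    ks ls : Fin m → ℕ
    ks i = width (ns (first m)) k i
    ls i = width (ns i) k i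

    ls≤ks : ∀ i → ls i ≤ ks i
    ls≤ks i = ⊓-monoˡ-≤ (k / suc (toℕ i)) (anti (first-≤ m i))

    out : List X
    out = List.concat (List.tabulate λ i → List.drop (ls i) (z i))

    res : Vec (X ₋) (∑ ks)
    res = X₋.⟦ mw-merge (∑ ks) (ks (first m)) k ⟧
            (joinBlocks ks λ i → padPrefix (ls≤ks i) (z i))

    -- X ₋ is Maybe X, so catMaybes is drop(⊥, _).
    output : List X
    output = catMaybes (toList res) List.++ out

  -- The result is a list, not a Vec X n: that drop(⊥, res) and out together
  -- have n elements holds only because networks permute their input.
  mw-sel : ∀ {n k} → Splits m n k → Vec X n → List X
  mw-sel     unchanged                         xs = toList xs
  mw-sel {n} maximum                           xs = toList (X.⟦ maxNet n ⟧ xs)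
  mw-sel     (split {k} _ ns anti _ subsplits) xs =
    Merge.output k ns anti λ i → mw-sel (subsplits i) (Columns.column ns anti xs i)

{-# OPTIONS --safe #-}
module Submission where

open import Defs
open import Data.Fin.Base as Fin using (Fin; zero; suc; toℕ; fromℕ<; inject≤)
open import Data.Fin.Permutation as Perm using (Permutation; _⟨$⟩ˡ_; _⟨$⟩ʳ_; flip; _∘ₚ_)
open import Data.Fin.Properties as Fin using ()
open import Data.List.Base as List using (List; []; _∷_; length; concatMap; allFin; catMaybes; filter; applyUpTo)
open import Data.List.Membership.Propositional using (_∈_; lose)
open import Data.List.Membership.Propositional.Properties.WithK using (unique∧set⇒bag)
open import Data.List.Properties as List using ()
open import Data.List.Relation.Binary.BagAndSetEquality using (∼bag⇒↭)
open import Data.List.Relation.Binary.Equality.Propositional using (≋⇒≡)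
open import Data.List.Relation.Binary.Permutation.Homogeneous using (onIndices)
open import Data.List.Relation.Binary.Permutation.Propositional
  using (_↭_; ↭-refl; ↭-sym; ↭-trans; ↭-reflexive; ↭⇒↭ₛ; module PermutationReasoning)
open import Data.List.Relation.Binary.Permutation.Propositional.Properties as ↭ using (↭-length)
open import Data.List.Relation.Unary.All as All using (All; []; _∷_)
open import Data.List.Relation.Unary.AllPairs as AllPairs using (AllPairs; []; _∷_)
open import Data.List.Relation.Unary.Any using (here; there)
open import Data.List.Relation.Unary.Linked using ([]; [-]; _∷_)
open import Data.List.Relation.Unary.Unique.Propositional using (Unique)
open import Data.Maybe.Base as Maybe using (Maybe; just; nothing)
open import Data.Nat.Base
  using (ℕ; zero; suc; 2+; _+_; _*_; _∸_; _⊓_; _/_; _%_; _≤_; _<_; z≤n; s≤s; s≤s⁻¹; NonTrivial; nonTrivial⇒nonZero)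
open import Data.Nat.DivMod using (m*n/n≡m; /-monoˡ-≤; /-monoʳ-≤; m≡m%n+[m/n]*n; m%n<n; n/1≡n)
open import Data.Nat.ListAction using (sum)
open import Data.Nat.ListAction.Properties using (sum-++)
open import Data.Nat.Properties as ℕ using (module ≤-Reasoning)
open import Data.Product.Base using (Σ; ∃; _×_; _,_; proj₁; proj₂)
open import Data.Sum.Base using (inj₁; inj₂)
open import Data.Unit.Base using (⊤; tt)
open import Data.Vec.Base as Vec using (Vec; []; _∷_; take; drop; lookup; tabulate; toList; fromList; cast; padRight)
open import Data.Vec.Properties as Vec using ()
open import Function.Base using (_∘_; id)
open import Function.Bundles using (mk⇔)
open import Level using (Level)
open import Relation.Binary.Bundles using (DecTotalOrder)
open import Relation.Binary.Construct.Add.Infimum.NonStrict using (_≤₋_; ⊥₋≤_; [_]; [≤]-injective)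
open import Relation.Binary.Core using (Rel)
open import Relation.Binary.PropositionalEquality using (_≡_; refl; sym; trans; cong; cong₂; subst; subst₂; setoid; module ≡-Reasoning)
open import Relation.Binary.Structures using (IsTotalOrder)
open import Relation.Nullary using (¬_; Dec; yes; no; contradiction)
open import Relation.Nullary.Construct.Add.Infimum using (_₋)
open import Relation.Unary using (Pred; Decidable)
import Algebra.Properties.CommutativeMonoid.Sum as Sum
import Data.List.Membership.Propositional.Properties as ∈
import Data.List.Relation.Binary.Permutation.Setoid.Properties as ↭ₛ
import Data.List.Relation.Unary.All.Properties as All
import Data.List.Relation.Unary.AllPairs.Properties as AllPairs
import Data.List.Relation.Unary.Sorted.TotalOrder.Properties as Sorted
import Data.List.Relation.Unary.Unique.Propositional.Properties as Unique
import Data.Maybe.Relation.Unary.Any as MaybeAny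
import Data.Vec.Relation.Unary.All.Properties as VecAll

-- The output is produced by a network: a sorter moves every ⊥ behind all other
-- values, so the positions of the ⊥s in the merger do not depend on the values
-- and each sorter of the merger acts on X as a smaller sorter. Networks are
-- handled through lists of wires, on which they can be run side by side.
--
-- For top k sortedness, call a value large if it is at least some fixed w. As
-- the rows are sorted, column i has at most as many large values as any earlier
-- column, and this passes to the selected prefixes, which are thus m-wise. If w
-- is left out in column i, every column up to i has more than q = ⌊k/i⌋ large
-- values, so the merger receives at least ∑_{j≤i} min(q + 1, ⌊k/j⌋) of them.
-- This sum is at least k, because k < i(q + 1); hence its first k outputs are
-- all large. With every value large, the same count shows that they are not ⊥.

-- Being a comparator network asks for one network that serves all inputs. The construction deletes
-- the ⊥s after the merger has moved them around, so the wire that ends at a given output must be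
-- known before any value is. The merger is arbitrary, hence it is simulated by recursion on its
-- syntax, with a fixed assignment of wires or ⊥ to its positions at every stage.
--
-- The ordering half depends on the network half: it uses that each recursive result is a
-- permutation of its column. Selection can destroy the pointwise order between columns, since each
-- column is rearranged on its own. The number of values above a threshold survives, and for sorted
-- sequences these numbers determine the pointwise order again. This is why domination, the absence
-- of ⊥ and the comparison with the left-out values are all derived from counts.
--
-- In the count, min(q + 1, ⌊k/j⌋) arises because the prefix of column j has length min(n_j, ⌊k/j⌋),
-- and n_j is at least q + 1 as the column holds that many large values.

private
  variable
    a a′ ℓ ℓ′ ℓᵖ : Level
    A B : Set a
    c k m n n′ p q : ℕ

-- Auxiliary facts on vectors and lists

toList-injective : {xs ys : Vec A n} → toList xs ≡ toList ys → xs ≡ ys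
toList-injective {xs = xs} {ys} eq =
  trans (sym (Vec.cast-is-id refl xs)) (Vec.toList-injective refl xs ys eq)

toList-tabulate : (f : Fin n → A) → toList (tabulate f) ≡ List.tabulate f
toList-tabulate {n = zero}  f = refl
toList-tabulate {n = suc n} f = cong (f zero ∷_) (toList-tabulate (f ∘ suc))

lookup-ext : {xs ys : Vec A n} → (∀ i → lookup xs i ≡ lookup ys i) → xs ≡ ys
lookup-ext {xs = xs} {ys} eq =
  trans (sym (Vec.tabulate∘lookup xs)) (trans (Vec.tabulate-cong eq) (Vec.tabulate∘lookup ys))

lookup-fromList : (xs : List A) (i : Fin (length xs)) → lookup (fromList xs) i ≡ List.lookup xs i
lookup-fromList (x ∷ xs) zero    = refl
lookup-fromList (x ∷ xs) (suc i) = lookup-fromList xs i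

map-fromList : (f : A → B) (xs : List A) → toList (Vec.map f (fromList xs)) ≡ List.map f xs
map-fromList f xs = trans (Vec.toList-map f (fromList xs)) (cong (List.map f) (Vec.toList∘fromList xs))

map-≡-++⁻ : ∀ {f g : A → B} (xs ys : List A) → List.map f (xs List.++ ys) ≡ List.map g (xs List.++ ys) →
          List.map f xs ≡ List.map g xs × List.map f ys ≡ List.map g ys
map-≡-++⁻ []       ys eq = refl , eq
map-≡-++⁻ (x ∷ xs) ys eq with map-≡-++⁻ xs ys (List.∷-injectiveʳ eq)
... | eq₁ , eq₂ = cong₂ _∷_ (List.∷-injectiveˡ eq) eq₁ , eq₂

map-≡-concat⁻ : ∀ {m} {f g : A → B} (L : Fin m → List A) →
                List.map f (List.concat (List.tabulate L)) ≡ List.map g (List.concat (List.tabulate L)) →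
                ∀ i → List.map f (L i) ≡ List.map g (L i)
map-≡-concat⁻ L eq zero    = proj₁ (map-≡-++⁻ (L zero) _ eq)
map-≡-concat⁻ L eq (suc i) = map-≡-concat⁻ (L ∘ suc) (proj₂ (map-≡-++⁻ (L zero) _ eq)) i

concatMap-↭ : (f : A → List B) {xs ys : List A} → xs ↭ ys → concatMap f xs ↭ concatMap f ys
concatMap-↭ f _↭_.refl            = ↭-refl
concatMap-↭ f (_↭_.prep x xs↭ys)  = ↭.++⁺ˡ (f x) (concatMap-↭ f xs↭ys)
concatMap-↭ f (_↭_.swap x y xs↭ys) = ↭-trans (↭.shifts (f x) (f y)) (↭.++⁺ˡ (f y) (↭.++⁺ˡ (f x) (concatMap-↭ f xs↭ys)))
concatMap-↭ f (_↭_.trans p q)     = ↭-trans (concatMap-↭ f p) (concatMap-↭ f q)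

-- Permuting positions

-- Lists up to ↭ form a commutative monoid, in which this is invariance of a sum under reindexing.
tabulate-↭ : (f : Fin n → A) (π : Permutation n′ n) →
             List.tabulate (λ i → f (π ⟨$⟩ʳ i)) ↭ List.tabulate f
tabulate-↭ {A = A} f π = begin
  List.tabulate (λ i → f (π ⟨$⟩ʳ i))   ≡⟨ singletons _ ⟨
  ↭-Sum.sum (λ i → f (π ⟨$⟩ʳ i) ∷ [])      ↭⟨ ↭-Sum.sum-permute (λ i → f i ∷ []) π ⟨
  ↭-Sum.sum (λ i → f i ∷ [])               ≡⟨ singletons f ⟩
  List.tabulate f                      ∎
  where
  open PermutationReasoning
  module ↭-Sum = Sum (↭.++-commutativeMonoid {A = A})
  singletons : (g : Fin n → A) → ↭-Sum.sum (λ i → g i ∷ []) ≡ List.tabulate g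
  singletons {zero}  g = refl
  singletons {suc n} g = cong (g zero ∷_) (singletons (g ∘ suc))

permute-↭ : (π : Permutation n n′) (xs : Vec A n) → toList (permute π xs) ↭ toList xs
permute-↭ π xs = begin
  toList (permute π xs)                          ≡⟨ toList-tabulate _ ⟩
  List.tabulate (λ i → lookup xs (π ⟨$⟩ˡ i))     ↭⟨ tabulate-↭ (lookup xs) (flip π) ⟩
  List.tabulate (lookup xs)                      ≡⟨ toList-tabulate (lookup xs) ⟨
  toList (tabulate (lookup xs))                  ≡⟨ cong toList (Vec.tabulate∘lookup xs) ⟩
  toList xs                                      ∎
  where open PermutationReasoning

map-permute : (f : A → B) (π : Permutation n n′) (xs : Vec A n) →
              Vec.map f (permute π xs) ≡ permute π (Vec.map f xs)
map-permute f π xs = trans (sym (Vec.tabulate-∘ f _))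
  (Vec.tabulate-cong λ i → sym (Vec.lookup-map (π ⟨$⟩ˡ i) f xs))

-- A proof of `_↭_` already contains a bijection of indices, which `onIndices` extracts; the casts
-- only turn list lengths into `c` and `n`. The two sizes stay distinct because a sorter needs `n`
-- in the form of a sum.
wiring : (ws : Vec (Fin c) n) → toList ws ↭ allFin c →
         ∃ λ (π : Permutation c n) → ∀ j → π ⟨$⟩ˡ j ≡ lookup ws j
wiring {c} {n} ws ws↭ =
  flip (Perm.cast-id n≡ ∘ₚ onIndices ↭ws ∘ₚ Perm.cast-id c≡) , eq
  where
  ws′ = fromList (toList ws)
  ↭ws = ↭⇒↭ₛ ws↭
  n≡ = sym (Vec.length-toList ws)
  c≡ = List.length-tabulate {n = c} id
  open ≡-Reasoning
  eq : ∀ j → _ ≡ lookup ws j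
  eq j = begin
    Fin.cast c≡ (onIndices ↭ws ⟨$⟩ʳ Fin.cast n≡ j)
      ≡⟨ List.lookup-tabulate id _ ⟨
    List.lookup (allFin c) (Fin.cast (sym c≡) (Fin.cast c≡ (onIndices ↭ws ⟨$⟩ʳ Fin.cast n≡ j)))
      ≡⟨ cong (List.lookup (allFin c)) (Fin.cast-involutive (sym c≡) c≡ _) ⟩
    List.lookup (allFin c) (onIndices ↭ws ⟨$⟩ʳ Fin.cast n≡ j)
      ≡⟨ ↭ₛ.onIndices-lookup (setoid _) ↭ws (Fin.cast n≡ j) ⟨
    List.lookup (toList ws) (Fin.cast n≡ j)
      ≡⟨ lookup-fromList (toList ws) _ ⟨
    lookup ws′ (Fin.cast n≡ j)
      ≡⟨ Vec.lookup-cast₁ (sym n≡) ws′ j ⟨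
    lookup (cast (sym n≡) ws′) j
      ≡⟨ cong (λ v → lookup v j) (Vec.fromList∘toList ws) ⟩
    lookup ws j ∎

module _ {ws : Vec (Fin c) n} (π : Permutation c n) (π≡ : ∀ j → π ⟨$⟩ˡ j ≡ lookup ws j) where

  permute-wiring : (xs : Vec A c) → permute π xs ≡ Vec.map (lookup xs) ws
  permute-wiring xs = lookup-ext λ j → begin
    lookup (permute π xs) j              ≡⟨ Vec.lookup∘tabulate _ j ⟩
    lookup xs (π ⟨$⟩ˡ j)                 ≡⟨ cong (lookup xs) (π≡ j) ⟩
    lookup xs (lookup ws j)              ≡⟨ Vec.lookup-map j (lookup xs) ws ⟨
    lookup (Vec.map (lookup xs) ws) j    ∎
    where open ≡-Reasoning

  -- A sorter writes its results back along `flip π`; reading the same wires afterwards undoes this.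
  permute-flip-wiring : (zs : Vec A n) → Vec.map (lookup (permute (flip π) zs)) ws ≡ zs
  permute-flip-wiring zs = lookup-ext λ j → begin
    lookup (Vec.map (lookup (permute (flip π) zs)) ws) j  ≡⟨ Vec.lookup-map j _ ws ⟩
    lookup (permute (flip π) zs) (lookup ws j)            ≡⟨ Vec.lookup∘tabulate _ (lookup ws j) ⟩
    lookup zs (π ⟨$⟩ʳ lookup ws j)                        ≡⟨ cong (λ x → lookup zs (π ⟨$⟩ʳ x)) (π≡ j) ⟨
    lookup zs (π ⟨$⟩ʳ (π ⟨$⟩ˡ j))                         ≡⟨ cong (lookup zs) (Perm.inverseʳ π) ⟩
    lookup zs j                                           ∎
    where open ≡-Reasoning

take-++ : (xs : Vec A p) (ys : Vec A q) → take p (xs Vec.++ ys) ≡ xs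
take-++ []       ys = refl
take-++ (x ∷ xs) ys = cong (x ∷_) (take-++ xs ys)

drop-++ : (xs : Vec A p) (ys : Vec A q) → drop p (xs Vec.++ ys) ≡ ys
drop-++ []       ys = refl
drop-++ (x ∷ xs) ys = drop-++ xs ys

-- Networks acting on wires

module Wires {A : Set a} {_≤ᴬ_ : Rel A ℓ} (O : IsTotalOrder _≡_ _≤ᴬ_) where
  open Ordered O

  toList-sortᵛ : (xs : Vec A n) → toList (sortᵛ xs) ≡ sort (toList xs)
  toList-sortᵛ xs = trans (Vec.toList-cast _ _) (Vec.toList∘fromList (sort (toList xs)))

  -- By antisymmetry a multiset has only one sorted arrangement. Outputs of `sort` can thus be
  -- identified without looking at the algorithm.
  sort-unique : ∀ {xs ys} → Sorted ys → ys ↭ xs → ys ≡ sort xs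
  sort-unique {xs} ys↗ ys↭xs = ≋⇒≡ (Sorted.↗↭↗⇒≋ (DecTotalOrder.totalOrder ≥-decTotalOrder) ys↗ (sort-↗ xs)
    (↭⇒↭ₛ (↭-trans ys↭xs (↭-sym (sort-↭ xs)))))

  ⟦_⟧-↭ : (N : Network n) (xs : Vec A n) → toList (⟦ N ⟧ xs) ↭ toList xs
  ⟦ rearrange π ⟧-↭ xs  = permute-↭ π xs
  ⟦ sorter p q π ⟧-↭ xs = begin
    toList (permute (flip π) (sortᵛ (take p ys) Vec.++ drop p ys)) ↭⟨ permute-↭ (flip π) _ ⟩
    toList (sortᵛ (take p ys) Vec.++ drop p ys)             ≡⟨ Vec.toList-++ (sortᵛ (take p ys)) _ ⟩
    toList (sortᵛ (take p ys)) List.++ toList (drop p ys)   ≡⟨ cong (List._++ toList (drop p ys)) (toList-sortᵛ (take p ys)) ⟩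
    sort (toList (take p ys)) List.++ toList (drop p ys)    ↭⟨ ↭.++⁺ʳ _ (sort-↭ _) ⟩
    toList (take p ys) List.++ toList (drop p ys)           ≡⟨ Vec.toList-++ (take p ys) _ ⟨
    toList (take p ys Vec.++ drop p ys)                     ≡⟨ cong toList (Vec.take++drop≡id p ys) ⟩
    toList ys                                               ↭⟨ permute-↭ π xs ⟩
    toList xs                                               ∎
    where
    open PermutationReasoning
    ys = permute π xs
  ⟦ N ⨾ N′ ⟧-↭ xs = ↭-trans (⟦ N′ ⟧-↭ (⟦ N ⟧ xs)) (⟦ N ⟧-↭ xs)

  idle : Network n
  idle = rearrange Perm.id

  ⟦idle⟧ : (xs : Vec A n) → ⟦ idle ⟧ xs ≡ xs
  ⟦idle⟧ = Vec.tabulate∘lookup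

  -- The wires of `L` are sent to the sorted positions and those of `R` to the positions left alone.
  -- That together they enumerate all wires is what makes this a permutation.
  sortWires : (L R : List (Fin c)) → L List.++ R ↭ allFin c → ∃ λ (M : Network c) → ∀ xs →
    List.map (lookup (⟦ M ⟧ xs)) L ≡ sort (List.map (lookup xs) L) ×
    List.map (lookup (⟦ M ⟧ xs)) R ≡ List.map (lookup xs) R
  sortWires {c} L R L++R↭ = sorter (length L) (length R) π , λ xs →
      trans (sym (map-fromList (lookup (⟦ M ⟧ xs)) L)) (trans (cong toList (on-L xs)) (trans (toList-sortᵛ _) (cong sort (map-fromList _ L))))
    , trans (sym (map-fromList (lookup (⟦ M ⟧ xs)) R)) (trans (cong toList (on-R xs)) (map-fromList _ R))
    where
    ws = fromList L Vec.++ fromList R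
    wir = wiring ws (↭-trans (↭-reflexive (trans (Vec.toList-++ (fromList L) (fromList R))
                 (cong₂ List._++_ (Vec.toList∘fromList L) (Vec.toList∘fromList R)))) L++R↭)
    π = proj₁ wir
    M = sorter (length L) (length R) π
    module _ (xs : Vec A c) where
      f = lookup xs
      g = lookup (⟦ M ⟧ xs)
      π-xs : permute π xs ≡ Vec.map f (fromList L) Vec.++ Vec.map f (fromList R)
      π-xs = trans (permute-wiring π (proj₂ wir) xs) (Vec.map-++ f (fromList L) (fromList R))
      both : Vec.map g (fromList L) Vec.++ Vec.map g (fromList R) ≡
             sortᵛ (take (length L) (permute π xs)) Vec.++ drop (length L) (permute π xs)
      both = trans (sym (Vec.map-++ g (fromList L) (fromList R))) (permute-flip-wiring π (proj₂ wir) _)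
      on-L : Vec.map g (fromList L) ≡ sortᵛ (Vec.map f (fromList L))
      on-L = trans (Vec.++-injectiveˡ _ _ both) (cong sortᵛ (trans (cong (take (length L)) π-xs) (take-++ _ _)))
      on-R : Vec.map g (fromList R) ≡ Vec.map f (fromList R)
      on-R = trans (Vec.++-injectiveʳ (Vec.map g (fromList L)) _ both) (trans (cong (drop (length L)) π-xs) (drop-++ (Vec.map f (fromList L)) _))

  -- Out carries the results of a computation h on the values carried by In; other wires are left alone.
  record Job {c : ℕ} (In : List (Fin c)) (h : (Fin c → A) → List A) : Set a where
    field
      Out    : List (Fin c)
      Out↭In : Out ↭ In
      local  : ∀ s s′ → List.map s In ≡ List.map s′ In → h s ≡ h s′
      run    : ∀ rest → In List.++ rest ↭ allFin c → ∃ λ (M : Network c) → ∀ xs →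
        List.map (lookup (⟦ M ⟧ xs)) Out ≡ h (lookup xs) ×
        List.map (lookup (⟦ M ⟧ xs)) rest ≡ List.map (lookup xs) rest
  open Job

  sortJob : (L : List (Fin c)) → Job L (λ s → sort (List.map s L))
  sortJob L = record
    { Out    = L
    ; Out↭In = ↭-refl
    ; local  = λ _ _ → cong sort
    ; run    = sortWires L
    }

  -- The jobs run one after another, each counting the wires of all the others as part of its
  -- `rest`. Earlier jobs change the assignment of values, but not on the inputs of later ones, so
  -- `local` gives those the results they would have on the original values.
  parallel : ∀ {m} {In : Fin m → List (Fin c)} {h : Fin m → (Fin c → A) → List A} (jobs : ∀ i → Job (In i) (h i)) rest →
    List.concat (List.tabulate In) List.++ rest ↭ allFin c → ∃ λ (M : Network c) → ∀ xs →
      (∀ i → List.map (lookup (⟦ M ⟧ xs)) (Out (jobs i)) ≡ h i (lookup xs)) ×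
      List.map (lookup (⟦ M ⟧ xs)) rest ≡ List.map (lookup xs) rest
  parallel {m = zero} jobs rest ↭all = idle , λ xs →
    (λ ()) , cong (λ ys → List.map (lookup ys) rest) (⟦idle⟧ xs)
  parallel {m = suc m} {In} {h} jobs rest ↭all =
    let M₁ , ok₁ = run (jobs zero) (Ins List.++ rest) (↭-trans (↭-reflexive (sym (List.++-assoc (In zero) Ins rest))) ↭all)
        M₂ , ok₂ = parallel {h = h ∘ suc} (jobs ∘ suc) (out List.++ rest) (begin
          Ins List.++ out List.++ rest      ↭⟨ ↭.shifts Ins out ⟩
          out List.++ Ins List.++ rest      ↭⟨ ↭.++⁺ʳ (Ins List.++ rest) (Out↭In (jobs zero)) ⟩
          In zero List.++ Ins List.++ rest  ≡⟨ List.++-assoc (In zero) Ins rest ⟨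
          (In zero List.++ Ins) List.++ rest ↭⟨ ↭all ⟩
          allFin _ ∎)
    in (M₁ ⨾ M₂) , λ xs →
      let xs₁ = ⟦ M₁ ⟧ xs
          out₁ , kept₁ = ok₁ xs
          outs₂ , kept₂ = ok₂ xs₁
          Ins≡ , rest≡ = map-≡-++⁻ Ins rest kept₁
          out≡ , rest≡₂ = map-≡-++⁻ out rest kept₂
      in (λ { zero    → trans out≡ out₁
            ; (suc i) → trans (outs₂ i) (local (jobs (suc i)) _ _ (map-≡-concat⁻ (In ∘ suc) Ins≡ i)) })
         , trans rest≡₂ rest≡
    where
    open PermutationReasoning
    out = Out (jobs zero)
    Ins = List.concat (List.tabulate (In ∘ suc))

  -- The output order prescribed by `L` is the same for every input, so a single final rearrangement
  -- realises it.
  gather : (M : Network c) (L : List (Fin c)) → L ↭ allFin c →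
           ∃ λ (N : Network c) → ∀ xs → List.map (lookup (⟦ M ⟧ xs)) L ≡ toList (⟦ N ⟧ xs)
  gather {c} M L L↭ = (M ⨾ rearrange (proj₁ wir)) , λ xs → begin
    List.map (lookup (⟦ M ⟧ xs)) L              ≡⟨ cong (List.map _) ws≡L ⟨
    List.map (lookup (⟦ M ⟧ xs)) (toList ws)    ≡⟨ Vec.toList-map _ ws ⟨
    toList (Vec.map (lookup (⟦ M ⟧ xs)) ws)     ≡⟨ cong toList (permute-wiring (proj₁ wir) (proj₂ wir) (⟦ M ⟧ xs)) ⟨
    toList (permute (proj₁ wir) (⟦ M ⟧ xs))     ∎
    where
    open ≡-Reasoning
    ws : Vec (Fin c) c
    ws = cast (trans (↭-length L↭) (List.length-tabulate {n = c} id)) (fromList L)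
    ws≡L : toList ws ≡ L
    ws≡L = trans (Vec.toList-cast _ _) (Vec.toList∘fromList L)
    wir = wiring ws (↭-trans (↭-reflexive ws≡L) L↭)

-- Running networks on chosen wires

-- A network over `B` is simulated by one over `A`: each of its positions holds a cell `w`, whose
-- value is computed from the wires `wires w`. There are two uses: a cell is one wire, or a cell is
-- either one wire or ⊥, which occupies no wire.
module Embedding
  {A : Set a} {_≤ᴬ_ : Rel A ℓ} (O : IsTotalOrder _≡_ _≤ᴬ_)
  {B : Set a′} {_≤ᴮ_ : Rel B ℓ′} (Q : IsTotalOrder _≡_ _≤ᴮ_)
  {W : Set} {c : ℕ} (wires : W → List (Fin c)) (value : (Fin c → A) → W → B)
  where
  private
    module A = Ordered O
    module B = Ordered Q
  open Wires

  wiresOf : Vec W n → List (Fin c)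
  wiresOf ws = concatMap wires (toList ws)

  -- The cells ws′ are where a sorter on the cells ws leaves its outputs
  -- once the values on the wires of ws have been sorted.
  SortsCells : Set _
  SortsCells = ∀ {p} (ws : Vec W p) → ∃ λ (ws′ : Vec W p) →
    wiresOf ws′ ≡ wiresOf ws ×
    (∀ s s′ → List.map s′ (wiresOf ws) ≡ A.sort (List.map s (wiresOf ws)) →
      toList (Vec.map (value s′) ws′) ≡ B.sort (toList (Vec.map (value s) ws)))

  ValueLocal : Set _
  ValueLocal = ∀ s s′ w → List.map s (wires w) ≡ List.map s′ (wires w) → value s w ≡ value s′ w

  module _ (sortsCells : SortsCells) (valueLocal : ValueLocal) where

    map-value-local : ∀ {s s′} (ws : Vec W n) → List.map s (wiresOf ws) ≡ List.map s′ (wiresOf ws) →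
                      Vec.map (value s) ws ≡ Vec.map (value s′) ws
    map-value-local []       eq = refl
    map-value-local (w ∷ ws) eq with map-≡-++⁻ (wires w) (wiresOf ws) eq
    ... | eq₁ , eq₂ = cong₂ _∷_ (valueLocal _ _ w eq₁) (map-value-local ws eq₂)

    wiresOf-++ : (vs : Vec W n) (ws : Vec W n′) → wiresOf (vs Vec.++ ws) ≡ wiresOf vs List.++ wiresOf ws
    wiresOf-++ vs ws = trans (cong (concatMap wires) (Vec.toList-++ vs ws)) (List.concatMap-++ wires (toList vs) (toList ws))

    -- The cells `ws′` are chosen before `xs`, so one `M` serves all values. A rearrangement merely
    -- relabels cells and needs no comparisons; at a sorter the choice is made by `sortsCells`.
    embed : (N : Network n) (ws : Vec W n) → ∃ λ (ws′ : Vec W n) → wiresOf ws′ ↭ wiresOf ws ×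
      (∀ rest → wiresOf ws List.++ rest ↭ allFin c → ∃ λ (M : Network c) → ∀ xs →
        Vec.map (value (lookup (A.⟦ M ⟧ xs))) ws′ ≡ B.⟦ N ⟧ (Vec.map (value (lookup xs)) ws) ×
        List.map (lookup (A.⟦ M ⟧ xs)) rest ≡ List.map (lookup xs) rest)
    embed (rearrange π) ws = permute π ws , concatMap-↭ wires (permute-↭ π ws) , λ rest _ → idle O , λ xs →
      let s≡ = cong lookup (⟦idle⟧ O xs) in
        trans (cong (λ s → Vec.map (value s) (permute π ws)) s≡) (map-permute _ π ws)
      , cong (λ s → List.map s rest) s≡
    embed (N ⨾ N′) ws with embed N ws
    ... | ws₁ , ws₁↭ , run₁ with embed N′ ws₁
    ... | ws₂ , ws₂↭ , run₂ = ws₂ , ↭-trans ws₂↭ ws₁↭ , λ rest ↭all →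
      let M₁ , ok₁ = run₁ rest ↭all
          M₂ , ok₂ = run₂ rest (↭-trans (↭.++⁺ʳ rest ws₁↭) ↭all)
      in (M₁ ⨾ M₂) , λ xs →
           trans (proj₁ (ok₂ (A.⟦ M₁ ⟧ xs))) (cong B.⟦ N′ ⟧ (proj₁ (ok₁ xs)))
         , trans (proj₂ (ok₂ (A.⟦ M₁ ⟧ xs))) (proj₂ (ok₁ xs))
    embed (sorter p q π) ws = ws′ , ws′↭ , λ rest ↭all →
      -- The simulating sorter has one input per wire of `vs₁`, hence fewer than `p` inputs when
      -- some cells carry no wire.
      let M , ok = sortWires O (wiresOf vs₁) (wiresOf vs₂ List.++ rest) (begin
            wiresOf vs₁ List.++ wiresOf vs₂ List.++ rest    ≡⟨ List.++-assoc (wiresOf vs₁) _ _ ⟨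
            (wiresOf vs₁ List.++ wiresOf vs₂) List.++ rest  ↭⟨ ↭.++⁺ʳ rest vs↭ ⟩
            wiresOf ws List.++ rest                         ↭⟨ ↭all ⟩
            allFin c                                        ∎)
      in M , λ xs →
        let s   = lookup xs
            s′  = lookup (A.⟦ M ⟧ xs)
            on-vs₂ , on-rest = map-≡-++⁻ (wiresOf vs₂) rest (proj₂ (ok xs))
            vs≡ = sym (map-permute (value s) π ws)
        in trans (map-permute (value s′) (flip π) (vs₁′ Vec.++ vs₂)) (cong (permute (flip π)) (trans (Vec.map-++ (value s′) vs₁′ vs₂)
             (cong₂ Vec._++_
               (trans (toList-injective (trans (sorts s s′ (proj₁ (ok xs))) (sym (toList-sortᵛ Q (Vec.map (value s) vs₁)))))
                      (cong B.sortᵛ (trans (sym (Vec.take-map (value s) p vs)) (cong (take p) (sym vs≡)))))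
               (trans (map-value-local vs₂ on-vs₂) (trans (sym (Vec.drop-map (value s) p vs)) (cong (drop p) (sym vs≡)))))))
         , on-rest
      where
      open PermutationReasoning
      vs  = permute π ws
      vs₁ = take p vs
      vs₂ = drop p vs
      vs₁′  = proj₁ (sortsCells vs₁)
      vs₁′≡ = proj₁ (proj₂ (sortsCells vs₁))
      sorts = proj₂ (proj₂ (sortsCells vs₁))
      ws′ = permute (flip π) (vs₁′ Vec.++ vs₂)
      vs↭ : wiresOf vs₁ List.++ wiresOf vs₂ ↭ wiresOf ws
      vs↭ = begin
        wiresOf vs₁ List.++ wiresOf vs₂   ≡⟨ wiresOf-++ vs₁ vs₂ ⟨
        wiresOf (vs₁ Vec.++ vs₂)          ≡⟨ cong wiresOf (Vec.take++drop≡id p vs) ⟩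
        wiresOf vs                        ↭⟨ concatMap-↭ wires (permute-↭ π ws) ⟩
        wiresOf ws                        ∎
      ws′↭ : wiresOf ws′ ↭ wiresOf ws
      ws′↭ = begin
        wiresOf ws′                       ↭⟨ concatMap-↭ wires (permute-↭ (flip π) (vs₁′ Vec.++ vs₂)) ⟩
        wiresOf (vs₁′ Vec.++ vs₂)         ≡⟨ wiresOf-++ vs₁′ vs₂ ⟩
        wiresOf vs₁′ List.++ wiresOf vs₂  ≡⟨ cong (List._++ wiresOf vs₂) vs₁′≡ ⟩
        wiresOf vs₁ List.++ wiresOf vs₂   ↭⟨ vs↭ ⟩
        wiresOf ws                        ∎

module _ {A : Set a} {_≤ᴬ_ : Rel A ℓ} (O : IsTotalOrder _≡_ _≤ᴬ_) where
  open Ordered O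
  open Wires O

  -- The instance in which every cell is a single wire; a sorter then leaves its results on the
  -- cells it was given, in the same order.
  networkJob : (N : Network n) (ws : Vec (Fin c) n) → Job (toList ws) (λ s → toList (⟦ N ⟧ (Vec.map s ws)))
  networkJob {n = n} {c = c} N ws = record
    { Out    = toList ws′
    ; Out↭In = subst₂ _↭_ (wires≡ ws′) (wires≡ ws) ws′↭
    ; local  = λ s s′ eq → cong (toList ∘ ⟦ N ⟧) (toList-injective
        (trans (Vec.toList-map s ws) (trans eq (sym (Vec.toList-map s′ ws)))))
    ; run    = λ rest ↭all →
        let M , ok = run (rest) (subst (λ L → L List.++ rest ↭ allFin c) (sym (wires≡ ws)) ↭all)
        in M , λ xs → trans (sym (Vec.toList-map _ ws′)) (cong toList (proj₁ (ok xs))) , proj₂ (ok xs)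
    }
    where
    open Embedding O O {c = c} List.[_] id
    wires≡ : ∀ {p} (vs : Vec (Fin c) p) → wiresOf vs ≡ toList vs
    wires≡ vs = List.concatMap-pure (toList vs)
    emb = embed
      (λ vs → vs , refl , λ s s′ eq → trans (Vec.toList-map s′ vs) (trans
        (subst (λ L → List.map s′ L ≡ sort (List.map s L)) (wires≡ vs) eq)
        (cong sort (sym (Vec.toList-map s vs)))))
      (λ _ _ _ → List.∷-injectiveˡ) N ws
    ws′ = proj₁ emb
    ws′↭ = proj₁ (proj₂ emb)
    run = proj₂ (proj₂ emb)

-- Blocks

map-block : (f : A → B) (ns : Fin m → ℕ) (xs : Vec A (∑ ns)) → ∀ i →
            Vec.map f (block ns xs i) ≡ block ns (Vec.map f xs) i
map-block f ns xs zero    = sym (Vec.take-map f (ns zero) xs)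
map-block f ns xs (suc i) = trans (map-block f (ns ∘ suc) (drop (ns zero) xs) i)
  (cong (λ ys → block (ns ∘ suc) ys i) (sym (Vec.drop-map f (ns zero) xs)))

block-joinBlocks : (ns : Fin m → ℕ) (xs : ∀ i → Vec A (ns i)) → ∀ i → block ns (joinBlocks ns xs) i ≡ xs i
block-joinBlocks ns xs zero    = take-++ (xs zero) _
block-joinBlocks ns xs (suc i) = trans (cong (λ ys → block (ns ∘ suc) ys i) (drop-++ (xs zero) _))
  (block-joinBlocks (ns ∘ suc) (xs ∘ suc) i)

concat-block : (ns : Fin m → ℕ) (xs : Vec A (∑ ns)) →
               List.concat (List.tabulate (λ i → toList (block ns xs i))) ≡ toList xs
concat-block {m = zero}  ns [] = refl
concat-block {m = suc m} ns xs = begin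
  toList (take n₀ xs) List.++ _                        ≡⟨ cong (toList (take n₀ xs) List.++_) (concat-block (ns ∘ suc) (drop n₀ xs)) ⟩
  toList (take n₀ xs) List.++ toList (drop n₀ xs)      ≡⟨ Vec.toList-++ (take n₀ xs) (drop n₀ xs) ⟨
  toList (take n₀ xs Vec.++ drop n₀ xs)                ≡⟨ cong toList (Vec.take++drop≡id n₀ xs) ⟩
  toList xs ∎
  where
  open ≡-Reasoning
  n₀ = ns zero

toList-joinBlocks : (ns : Fin m → ℕ) (xs : ∀ i → Vec A (ns i)) →
                    toList (joinBlocks ns xs) ≡ List.concat (List.tabulate (toList ∘ xs))
toList-joinBlocks {m = zero}  ns xs = refl
toList-joinBlocks {m = suc m} ns xs = trans (Vec.toList-++ (xs zero) _)
  (cong (toList (xs zero) List.++_) (toList-joinBlocks (ns ∘ suc) (xs ∘ suc)))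

joinBlocks-cong : (ns : Fin m → ℕ) {xs ys : ∀ i → Vec A (ns i)} → (∀ i → xs i ≡ ys i) →
                  joinBlocks ns xs ≡ joinBlocks ns ys
joinBlocks-cong {m = zero}  ns eq = refl
joinBlocks-cong {m = suc m} ns eq = cong₂ Vec._++_ (eq zero) (joinBlocks-cong (ns ∘ suc) (eq ∘ suc))

map-joinBlocks : (f : A → B) (ns : Fin m → ℕ) (xs : ∀ i → Vec A (ns i)) →
                 Vec.map f (joinBlocks ns xs) ≡ joinBlocks ns (Vec.map f ∘ xs)
map-joinBlocks {m = zero}  f ns xs = refl
map-joinBlocks {m = suc m} f ns xs = trans (Vec.map-++ f (xs zero) _)
  (cong (Vec.map f (xs zero) Vec.++_) (map-joinBlocks f (ns ∘ suc) (xs ∘ suc)))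

concat-tabulate-++ : (f g : Fin m → List A) →
  List.concat (List.tabulate f) List.++ List.concat (List.tabulate g) ↭ List.concat (List.tabulate (λ i → f i List.++ g i))
concat-tabulate-++ {m = zero}  f g = ↭-refl
concat-tabulate-++ {m = suc m} f g = begin
  (f₀ List.++ fs) List.++ g₀ List.++ gs   ≡⟨ List.++-assoc f₀ fs _ ⟩
  f₀ List.++ fs List.++ g₀ List.++ gs     ↭⟨ ↭.++⁺ˡ f₀ (↭.shifts fs g₀) ⟩
  f₀ List.++ g₀ List.++ fs List.++ gs     ↭⟨ ↭.++⁺ˡ f₀ (↭.++⁺ˡ g₀ (concat-tabulate-++ (f ∘ suc) (g ∘ suc))) ⟩
  f₀ List.++ g₀ List.++ List.concat (List.tabulate (λ i → f (suc i) List.++ g (suc i))) ≡⟨ List.++-assoc f₀ g₀ _ ⟨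
  (f₀ List.++ g₀) List.++ List.concat (List.tabulate (λ i → f (suc i) List.++ g (suc i))) ∎
  where
  open PermutationReasoning
  f₀ = f zero
  g₀ = g zero
  fs = List.concat (List.tabulate (f ∘ suc))
  gs = List.concat (List.tabulate (g ∘ suc))

concat-tabulate-↭ : {f g : Fin m → List A} → (∀ i → f i ↭ g i) →
                    List.concat (List.tabulate f) ↭ List.concat (List.tabulate g)
concat-tabulate-↭ {m = zero}  eq = ↭-refl
concat-tabulate-↭ {m = suc m} eq = ↭.++⁺ (eq zero) (concat-tabulate-↭ (eq ∘ suc))

catMaybes-concat : (xss : Fin m → List (Maybe A)) →
  catMaybes (List.concat (List.tabulate xss)) ≡ List.concat (List.tabulate (catMaybes ∘ xss))
catMaybes-concat {m = zero}  xss = refl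
catMaybes-concat {m = suc m} xss = trans (List.catMaybes-++ (xss zero) _)
  (cong (catMaybes (xss zero) List.++_) (catMaybes-concat (xss ∘ suc)))

-- Splitting the vector of all positions into blocks avoids any arithmetic with offsets: naturality
-- of `block` gives the value found there.
wire : (ns : Fin m → ℕ) → ∀ i → Fin (ns i) → Fin (∑ ns)
wire ns i j = lookup (block ns (Vec.allFin _) i) j

lookup-wire : (ns : Fin m → ℕ) (xs : Vec A (∑ ns)) → ∀ i j → lookup xs (wire ns i j) ≡ lookup (block ns xs i) j
lookup-wire ns xs i j = begin
  lookup xs (wire ns i j)                                    ≡⟨ Vec.lookup-map j (lookup xs) (block ns (Vec.allFin _) i) ⟨
  lookup (Vec.map (lookup xs) (block ns (Vec.allFin _) i)) j ≡⟨ cong (λ ys → lookup ys j) (map-block (lookup xs) ns _ i) ⟩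
  lookup (block ns (Vec.map (lookup xs) (Vec.allFin _)) i) j ≡⟨ cong (λ ys → lookup (block ns ys i) j) (Vec.map-lookup-allFin xs) ⟩
  lookup (block ns xs i) j                                   ∎
  where open ≡-Reasoning

-- Label every position with its block and its index in it. The label can be read off at the
-- position, so the position determines the pair.
wire-injective : (ns : Fin m → ℕ) {x y : Σ (Fin m) (Fin ∘ ns)} →
                 wire ns (proj₁ x) (proj₂ x) ≡ wire ns (proj₁ y) (proj₂ y) → x ≡ y
wire-injective ns {x} {y} eq = trans (sym (located x)) (trans (cong (lookup locations) eq) (located y))
  where
  locations : Vec (Σ (Fin _) (Fin ∘ ns)) (∑ ns)
  locations = joinBlocks ns λ i → tabulate (i ,_)
  located : ∀ z → lookup locations (wire ns (proj₁ z) (proj₂ z)) ≡ z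
  located (i , j) = trans (lookup-wire ns locations i j)
    (trans (cong (λ ys → lookup ys j) (block-joinBlocks ns _ i)) (Vec.lookup∘tabulate _ j))

wire-surjective : (ns : Fin m → ℕ) → ∀ x → ∃ λ i → ∃ λ j → wire ns i j ≡ x
wire-surjective {m} ns x with ∈.∈-concat⁻′ {v = x} (List.tabulate (λ i → toList (block ns (Vec.allFin _) i)))
  (subst (x ∈_) (sym (trans (concat-block ns (Vec.allFin _)) (toList-tabulate id))) (∈.∈-allFin x))
... | L , x∈L , L∈ with ∈.∈-tabulate⁻ L∈
... | i , refl with ∈.∈-tabulate⁻ (subst (x ∈_) (trans (sym (cong toList (Vec.tabulate∘lookup (block ns (Vec.allFin _) i)))) (toList-tabulate _)) x∈L)
... | j , x≡ = i , j , sym x≡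

-- For lists without repetitions, having the same elements already means having them equally often.
full⇒↭allFin : {L : List (Fin n)} → Unique L → (∀ x → x ∈ L) → L ↭ allFin n
full⇒↭allFin {n} uniq full = ∼bag⇒↭ (unique∧set⇒bag uniq (Unique.allFin⁺ n)
  (mk⇔ (λ _ → ∈.∈-allFin _) (λ _ → full _)))

-- Padding

toList-padRight : (m≤n : m ≤ n) (x : A) (xs : Vec A m) →
                  toList (padRight m≤n x xs) ≡ toList xs List.++ List.replicate (n ∸ m) x
toList-padRight z≤n       x []       = Vec.toList-replicate _ x
toList-padRight (s≤s m≤n) x (y ∷ xs) = cong (y ∷_) (toList-padRight m≤n x xs)

catMaybes-pad : (xs : List A) (r : ℕ) → catMaybes (List.map just xs List.++ List.replicate r nothing) ≡ xs
catMaybes-pad []       zero    = refl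
catMaybes-pad []       (suc r) = catMaybes-pad [] r
catMaybes-pad (x ∷ xs) r       = cong (x ∷_) (catMaybes-pad xs r)

map-pad : (f : A → B) (xs : List A) (r : ℕ) →
          List.map (Maybe.map f) (List.map just xs List.++ List.replicate r nothing) ≡
          List.map just (List.map f xs) List.++ List.replicate r nothing
map-pad f xs r = begin
  List.map (Maybe.map f) (List.map just xs List.++ List.replicate r nothing)
    ≡⟨ List.map-++ (Maybe.map f) (List.map just xs) _ ⟩
  List.map (Maybe.map f) (List.map just xs) List.++ List.map (Maybe.map f) (List.replicate r nothing)
    ≡⟨ cong₂ List._++_ (trans (sym (List.map-∘ xs)) (List.map-∘ xs)) (List.map-replicate (Maybe.map f) r nothing) ⟩
  List.map just (List.map f xs) List.++ List.replicate r nothing ∎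
  where open ≡-Reasoning

-- Moving every `nothing` to the end loses nothing, which makes the padded form a candidate for the
-- sorted one.
pad-↭ : (xs : List (Maybe A)) →
        List.map just (catMaybes xs) List.++ List.replicate (length xs ∸ length (catMaybes xs)) nothing ↭ xs
pad-↭ []             = ↭-refl
pad-↭ (just x ∷ xs)  = _↭_.prep (just x) (pad-↭ xs)
pad-↭ (nothing ∷ xs) = begin
  js List.++ List.replicate (suc (length xs) ∸ length (catMaybes xs)) nothing
    ≡⟨ cong (λ r → js List.++ List.replicate r nothing) (ℕ.+-∸-assoc 1 (List.length-catMaybes xs)) ⟩
  js List.++ List.[ nothing ] List.++ List.replicate (length xs ∸ length (catMaybes xs)) nothing
    ↭⟨ ↭.shift nothing js _ ⟩
  nothing ∷ js List.++ List.replicate (length xs ∸ length (catMaybes xs)) nothing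
    ↭⟨ _↭_.prep nothing (pad-↭ xs) ⟩
  nothing ∷ xs ∎
  where
  open PermutationReasoning
  js = List.map just (catMaybes xs)

module _ {A : Set a} {_≤ᴬ_ : Rel A ℓ} (O : IsTotalOrder _≡_ _≤ᴬ_) where
  private
    module A  = Ordered O
    module A₋ = Ordered (withBottom O)
  open Wires

  pad-↗ : ∀ {xs} → A.Sorted xs → ∀ r → A₋.Sorted (List.map just xs List.++ List.replicate r nothing)
  pad-↗ []       zero          = []
  pad-↗ []       (suc zero)    = [-]
  pad-↗ []       (suc (suc r)) = (⊥₋≤ _) ∷ pad-↗ [] (suc r)
  pad-↗ [-]      zero          = [-]
  pad-↗ [-]      (suc r)       = (⊥₋≤ _) ∷ pad-↗ [] (suc r)
  pad-↗ (x≥y ∷ xs↗) r          = [ x≥y ] ∷ pad-↗ xs↗ r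

  -- A sorter moves ⊥s behind all other values, so where they end up does not depend on those values.
  module _ {c : ℕ} where
    open Embedding O (withBottom O) {c = c} List.fromMaybe Maybe.map

    wiresOf≡catMaybes : (ws : Vec (Maybe (Fin c)) n) → wiresOf ws ≡ catMaybes (toList ws)
    wiresOf≡catMaybes ws = sym (List.catMaybes-concatMap (toList ws))

    ⊥-sortsCells : SortsCells
    ⊥-sortsCells {p} ws = ws′ , ws′≡ , sorts
      where
      L = catMaybes (toList ws)
      r = p ∸ length L
      L≤ : length L ≤ p
      L≤ = ℕ.≤-trans (List.length-catMaybes (toList ws)) (ℕ.≤-reflexive (Vec.length-toList ws))
      ws′ = padRight L≤ nothing (Vec.map just (fromList L))
      toList-ws′ : toList ws′ ≡ List.map just L List.++ List.replicate r nothing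
      toList-ws′ = trans (toList-padRight L≤ nothing _) (cong (List._++ List.replicate r nothing) (map-fromList just L))
      ws′≡ : wiresOf ws′ ≡ wiresOf ws
      ws′≡ = begin
        wiresOf ws′             ≡⟨ wiresOf≡catMaybes ws′ ⟩
        catMaybes (toList ws′)  ≡⟨ trans (cong catMaybes toList-ws′) (catMaybes-pad L r) ⟩
        L                       ≡⟨ wiresOf≡catMaybes ws ⟨
        wiresOf ws              ∎
        where open ≡-Reasoning
      sorts : ∀ s s′ → List.map s′ (wiresOf ws) ≡ A.sort (List.map s (wiresOf ws)) →
              toList (Vec.map (Maybe.map s′) ws′) ≡ A₋.sort (toList (Vec.map (Maybe.map s) ws))
      -- The padded list is sorted and has the values of `ws`, so by uniqueness it is what the
      -- sorter over `X ₋` outputs.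
      sorts s s′ eq = trans ws′-values (sort-unique (withBottom O) (pad-↗ (A.sort-↗ _) r) ↭ws)
        where
        ws′-values : toList (Vec.map (Maybe.map s′) ws′) ≡
                     List.map just (A.sort (List.map s L)) List.++ List.replicate r nothing
        ws′-values = begin
          toList (Vec.map (Maybe.map s′) ws′)       ≡⟨ Vec.toList-map (Maybe.map s′) ws′ ⟩
          List.map (Maybe.map s′) (toList ws′)      ≡⟨ cong (List.map (Maybe.map s′)) toList-ws′ ⟩
          List.map (Maybe.map s′) _                 ≡⟨ map-pad s′ L r ⟩
          List.map just (List.map s′ L) List.++ List.replicate r nothing
            ≡⟨ cong (λ ys → List.map just ys List.++ List.replicate r nothing)
                 (subst (λ L → List.map s′ L ≡ A.sort (List.map s L)) (wiresOf≡catMaybes ws) eq) ⟩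
          List.map just (A.sort (List.map s L)) List.++ List.replicate r nothing ∎
          where open ≡-Reasoning
        ↭ws : List.map just (A.sort (List.map s L)) List.++ List.replicate r nothing ↭ toList (Vec.map (Maybe.map s) ws)
        ↭ws = begin
          List.map just (A.sort (List.map s L)) List.++ List.replicate r nothing
            ↭⟨ ↭.++⁺ʳ _ (↭.map⁺ just (A.sort-↭ _)) ⟩
          List.map just (List.map s L) List.++ List.replicate r nothing
            ≡⟨ map-pad s L r ⟨
          List.map (Maybe.map s) (List.map just L List.++ List.replicate r nothing)
            ≡⟨ cong (λ n → List.map (Maybe.map s) (List.map just L List.++ List.replicate (n ∸ length L) nothing)) (Vec.length-toList ws) ⟨
          List.map (Maybe.map s) (List.map just L List.++ List.replicate (length (toList ws) ∸ length L) nothing)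
            ↭⟨ ↭.map⁺ (Maybe.map s) (pad-↭ (toList ws)) ⟩
          List.map (Maybe.map s) (toList ws)
            ≡⟨ Vec.toList-map (Maybe.map s) ws ⟨
          toList (Vec.map (Maybe.map s) ws) ∎
          where open PermutationReasoning

    ⊥-valueLocal : ValueLocal
    ⊥-valueLocal s s′ nothing  eq = refl
    ⊥-valueLocal s s′ (just w) eq = cong just (List.∷-injectiveˡ eq)

    ⊥-embed : (N : Network n) (ws : Vec (Maybe (Fin c)) n) →
      ∃ λ (ws′ : Vec (Maybe (Fin c)) n) → catMaybes (toList ws′) ↭ catMaybes (toList ws) ×
      (∀ rest → catMaybes (toList ws) List.++ rest ↭ allFin c → ∃ λ (M : Network c) → ∀ xs →
        Vec.map (Maybe.map (lookup (A.⟦ M ⟧ xs))) ws′ ≡ A₋.⟦ N ⟧ (Vec.map (Maybe.map (lookup xs)) ws) ×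
        List.map (lookup (A.⟦ M ⟧ xs)) rest ≡ List.map (lookup xs) rest)
    ⊥-embed N ws =
      let ws′ , ws′↭ , run = embed ⊥-sortsCells ⊥-valueLocal N ws
      in ws′ , subst₂ _↭_ (wiresOf≡catMaybes ws′) (wiresOf≡catMaybes ws) ws′↭ ,
         λ rest ↭all → run rest (subst (λ L → L List.++ rest ↭ allFin c) (sym (wiresOf≡catMaybes ws)) ↭all)

-- Padded prefixes, rows and columns

module _ {X : Set a} {_≤ˣ_ : Rel X ℓ} (O : IsTotalOrder _≡_ _≤ˣ_) (m : ℕ) .{{_ : NonTrivial m}}
  (maxNet : ∀ n → Network n) (mw-merge : ∀ s (c k : ℕ) → Network s) where
  open Selection O m maxNet mw-merge

  toList-padPrefix : ∀ {l r} (l≤r : l ≤ r) (zs : List X) → toList (padPrefix l≤r zs) ≡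
    List.map just (List.take l zs) List.++ List.replicate (r ∸ length (List.take l zs)) nothing
  toList-padPrefix {l} {r} l≤r zs = trans
    (toList-padRight (ℕ.≤-trans (ℕ.≤-trans (ℕ.≤-reflexive (List.length-take l zs)) (ℕ.m⊓n≤m l (length zs))) l≤r)
      nothing (Vec.map just (fromList (List.take l zs))))
    (cong (List._++ List.replicate (r ∸ length (List.take l zs)) nothing) (map-fromList just (List.take l zs)))

  catMaybes-padPrefix : ∀ {l r} (l≤r : l ≤ r) (zs : List X) → catMaybes (toList (padPrefix l≤r zs)) ≡ List.take l zs
  catMaybes-padPrefix {l} l≤r zs =
    trans (cong catMaybes (toList-padPrefix l≤r zs)) (catMaybes-pad (List.take l zs) _)

  module _ (ns : Fin m → ℕ) (anti : Antitone m ns) (xs : Vec X (∑ ns)) where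
    open Rows ns
    open Columns ns anti xs

    lookup-row : ∀ j i → ∃ λ i′ → ∃ λ (j′ : Fin (ns i′)) → toℕ i′ ≡ toℕ i × toℕ j′ ≡ j ×
                 lookup (row j) i ≡ lookup (block ns xs i′) j′
    lookup-row j i = _ , _ , Fin.toℕ-inject≤ i (rowLength≤m j) , Fin.toℕ-fromℕ< _ , Vec.lookup∘tabulate _ i

    -- Rows and columns are two readings of one array. If each row is sorted in place on its own
    -- wires, column `i` therefore lies on the wires of block `i`.
    lookup-row-column : ∀ i (j : Fin (ns i)) →
      lookup (row (toℕ j)) (fromℕ< (<rowLength⁺ i (Fin.toℕ<n j))) ≡ lookup (block ns xs i) j
    lookup-row-column i j = let i′ , j′ , i′≡ , j′≡ , eq = lookup-row (toℕ j) _ in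
      trans eq (same i′ j′ (Fin.toℕ-injective (trans i′≡ (Fin.toℕ-fromℕ< _))) j′≡)
      where
      same : ∀ i′ (j′ : Fin (ns i′)) → i′ ≡ i → toℕ j′ ≡ toℕ j → lookup (block ns xs i′) j′ ≡ lookup (block ns xs i) j
      same i′ j′ refl j′≡j = cong (lookup (block ns xs i)) (Fin.toℕ-injective j′≡j)

-- The selection as a comparator network

module _ {X : Set a} {_≤ˣ_ : Rel X ℓ} (O : IsTotalOrder _≡_ _≤ˣ_) (m : ℕ) .{{_ : NonTrivial m}}
  (maxNet : ∀ n → Network n) (mw-merge : ∀ s (c k : ℕ) → Network s) where
  open Ordered O
  open Wires O
  open Job
  open Selection O m maxNet mw-merge
  private
    module X₋ = Ordered (withBottom O)

    -- The construction applied to the positions of the inputs instead of their values.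
    module Wire {c : ℕ} = Selection (Fin.≤-isTotalOrder {c}) m maxNet mw-merge

  -- Taking and padding depend on lengths alone, so they commute with reading values off the wires.
  map-padPrefix : ∀ {l r} (l≤r : l ≤ r) (s : Fin c → X) (zs : List (Fin c)) →
                  Vec.map (Maybe.map s) (Wire.padPrefix l≤r zs) ≡ padPrefix l≤r (List.map s zs)
  map-padPrefix {l = l} {r} l≤r s zs = toList-injective (begin
    toList (Vec.map (Maybe.map s) (Wire.padPrefix l≤r zs))
      ≡⟨ Vec.toList-map (Maybe.map s) (Wire.padPrefix l≤r zs) ⟩
    List.map (Maybe.map s) (toList (Wire.padPrefix l≤r zs))
      ≡⟨ cong (List.map (Maybe.map s)) (toList-padPrefix Fin.≤-isTotalOrder m maxNet mw-merge l≤r zs) ⟩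
    List.map (Maybe.map s) (List.map just (List.take l zs) List.++ List.replicate (r ∸ length (List.take l zs)) nothing)
      ≡⟨ map-pad s (List.take l zs) _ ⟩
    List.map just (List.map s (List.take l zs)) List.++ List.replicate (r ∸ length (List.take l zs)) nothing
      ≡⟨ cong (λ n → List.map just (List.map s (List.take l zs)) List.++ List.replicate (r ∸ n) nothing) (List.length-map s (List.take l zs)) ⟨
    List.map just (List.map s (List.take l zs)) List.++ List.replicate (r ∸ length (List.map s (List.take l zs))) nothing
      ≡⟨ cong (λ ys → List.map just ys List.++ List.replicate (r ∸ length ys) nothing) (List.take-map l zs) ⟨
    List.map just (List.take l (List.map s zs)) List.++ List.replicate (r ∸ length (List.take l (List.map s zs))) nothing
      ≡⟨ toList-padPrefix O m maxNet mw-merge l≤r (List.map s zs) ⟨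
    toList (padPrefix l≤r (List.map s zs)) ∎)
    where open ≡-Reasoning

  -- The recursive calls are abstracted to arbitrary comparator networks `f i`, which isolates one
  -- level of the recursion.
  module SplitNetwork (k : ℕ) (ns : Fin m → ℕ) (anti : Antitone m ns)
    (f : ∀ i → Vec X (ns i) → List X) (f-net : ∀ i → IsComparatorNetwork (f i)) where
    open Rows ns
    c₀ = ∑ ns
    n₁ = ns (first m)

    wireRow : ∀ j → Vec (Fin c₀) (rowLength j)
    wireRow = Wire.Columns.row ns anti (Vec.allFin c₀)

    wireColumn : ∀ i → Vec (Fin c₀) (ns i)
    wireColumn i = block ns (Vec.allFin c₀) i

    row-wires : ∀ xs j → Columns.row ns anti xs j ≡ Vec.map (lookup xs) (wireRow j)
    row-wires xs j = trans (Vec.tabulate-cong λ i →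
      let i′ , j′ , _ = lookup-row O m maxNet mw-merge ns anti xs j i in sym (lookup-wire ns xs i′ j′)) (Vec.tabulate-∘ (lookup xs) _)

    ∈-wireRow⁻ : ∀ {j x} → x ∈ toList (wireRow j) → ∃ λ i → x ≡ lookup (wireRow j) i
    ∈-wireRow⁻ {j} {x} x∈ = ∈.∈-tabulate⁻ (subst (x ∈_)
      (trans (sym (cong toList (Vec.tabulate∘lookup (wireRow j)))) (toList-tabulate _)) x∈)

    ∈-wireRow⁺ : ∀ j i → lookup (wireRow j) i ∈ toList (wireRow j)
    ∈-wireRow⁺ j i = subst (lookup (wireRow j) i ∈_)
      (trans (sym (toList-tabulate _)) (cong toList (Vec.tabulate∘lookup (wireRow j)))) (∈.∈-tabulate⁺ i)

    lookup-wireRow-injective : ∀ {j j′ i i′} → lookup (wireRow j) i ≡ lookup (wireRow j′) i′ → j ≡ j′ × toℕ i ≡ toℕ i′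
    lookup-wireRow-injective {j} {j′} {i} {i′} eq =
      let p , q , p≡ , q≡ , eq₁ = lookup-row Fin.≤-isTotalOrder m maxNet mw-merge ns anti (Vec.allFin c₀) j i
          p′ , q′ , p′≡ , q′≡ , eq₂ = lookup-row Fin.≤-isTotalOrder m maxNet mw-merge ns anti (Vec.allFin c₀) j′ i′
          same = wire-injective ns {p , q} {p′ , q′} (trans (sym eq₁) (trans eq eq₂))
      in trans (sym q≡) (trans (cong (λ z → toℕ (proj₂ z)) same) q′≡) ,
         trans (sym p≡) (trans (cong (λ z → toℕ (proj₁ z)) same) p′≡)

    wireRows : List (Fin c₀)
    wireRows = List.concat (List.tabulate {n = n₁} (λ j → toList (wireRow (toℕ j))))

    wireRows-unique : Unique wireRows
    wireRows-unique = Unique.concat⁺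
      (All.tabulate⁺ λ (j : Fin n₁) → subst Unique (trans (sym (toList-tabulate _)) (cong toList (Vec.tabulate∘lookup (wireRow (toℕ j)))))
        (Unique.tabulate⁺ λ eq → Fin.toℕ-injective (proj₂ (lookup-wireRow-injective {toℕ j} {toℕ j} eq))))
      (AllPairs.tabulate⁺ {n = n₁} λ j≢j′ (x∈ , x∈′) →
        let i , eq = ∈-wireRow⁻ x∈ ; i′ , eq′ = ∈-wireRow⁻ x∈′
        in j≢j′ (Fin.toℕ-injective (proj₁ (lookup-wireRow-injective (trans (sym eq) eq′)))))

    wireRows-full : ∀ x → x ∈ wireRows
    wireRows-full x =
      let i , j , wire≡x = wire-surjective ns x
          -- The first column is the longest, so `n₁` rows reach every element of every block.
          j′ = inject≤ j (anti (first-≤ m i))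
      in ∈.∈-concat⁺′
        (subst (λ j → x ∈ toList (wireRow j)) (sym (Fin.toℕ-inject≤ j _))
          (subst (_∈ toList (wireRow (toℕ j)))
            (trans (lookup-row-column Fin.≤-isTotalOrder m maxNet mw-merge ns anti (Vec.allFin c₀) i j) wire≡x)
            (∈-wireRow⁺ (toℕ j) _)))
        (∈.∈-tabulate⁺ j′)

    sortRows : ∃ λ (M : Network c₀) → ∀ xs → (∀ i →
      Columns.column ns anti xs i ≡ Vec.map (lookup (⟦ M ⟧ xs)) (wireColumn i))
    sortRows =
      let M , ok = parallel (λ (j : Fin n₁) → sortJob (toList (wireRow (toℕ j)))) []
                     (↭-trans (↭-reflexive (List.++-identityʳ wireRows)) (full⇒↭allFin wireRows-unique wireRows-full))
      in M , λ xs i → columns (lookup (⟦ M ⟧ xs)) xs (proj₁ (ok xs)) i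
      where
      module _ (s : Fin c₀ → X) (xs : Vec X c₀)
        (sorted : ∀ (j : Fin n₁) → List.map s (toList (wireRow (toℕ j))) ≡ sort (List.map (lookup xs) (toList (wireRow (toℕ j))))) where

        rows : ∀ j → j < n₁ → sortᵛ (Columns.row ns anti xs j) ≡ Vec.map s (wireRow j)
        rows j j<n₁ = toList-injective (begin
          toList (sortᵛ (Columns.row ns anti xs j))           ≡⟨ toList-sortᵛ _ ⟩
          sort (toList (Columns.row ns anti xs j))            ≡⟨ cong (sort ∘ toList) (row-wires xs j) ⟩
          sort (toList (Vec.map (lookup xs) (wireRow j)))     ≡⟨ cong sort (Vec.toList-map (lookup xs) (wireRow j)) ⟩
          sort (List.map (lookup xs) (toList (wireRow j)))    ≡⟨ subst (λ j → List.map s (toList (wireRow j)) ≡ sort (List.map (lookup xs) (toList (wireRow j))))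
                                                                    (Fin.toℕ-fromℕ< j<n₁) (sorted (fromℕ< j<n₁)) ⟨
          List.map s (toList (wireRow j))                     ≡⟨ Vec.toList-map s (wireRow j) ⟨
          toList (Vec.map s (wireRow j))                      ∎)
          where open ≡-Reasoning

        columns : ∀ i → Columns.column ns anti xs i ≡ Vec.map s (wireColumn i)
        columns i = lookup-ext λ j →
          let r = fromℕ< (<rowLength⁺ i (Fin.toℕ<n j)) in begin
          lookup (Columns.column ns anti xs i) j                    ≡⟨ Vec.lookup∘tabulate _ j ⟩
          lookup (sortᵛ (Columns.row ns anti xs (toℕ j))) r         ≡⟨ cong (λ ys → lookup ys r) (rows (toℕ j) (ℕ.<-≤-trans (Fin.toℕ<n j) (anti (first-≤ m i)))) ⟩
          lookup (Vec.map s (wireRow (toℕ j))) r                    ≡⟨ Vec.lookup-map r s (wireRow (toℕ j)) ⟩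
          s (lookup (wireRow (toℕ j)) r)                            ≡⟨ cong s (lookup-row-column Fin.≤-isTotalOrder m maxNet mw-merge ns anti (Vec.allFin c₀) i j) ⟩
          s (lookup (wireColumn i) j)                               ≡⟨ Vec.lookup-map j s (wireColumn i) ⟨
          lookup (Vec.map s (wireColumn i)) j                       ∎
          where open ≡-Reasoning

    wireColumns-↭ : List.concat (List.tabulate (toList ∘ wireColumn)) ↭ allFin c₀
    wireColumns-↭ = ↭-reflexive (trans (concat-block ns (Vec.allFin c₀)) (toList-tabulate id))

    columnJob : ∀ i → Job (toList (wireColumn i)) (λ s → toList (⟦ proj₁ (f-net i) ⟧ (Vec.map s (wireColumn i))))
    columnJob i = networkJob O (proj₁ (f-net i)) (wireColumn i)

    selected : Fin m → List (Fin c₀)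
    selected i = Out (columnJob i)

    selectColumns : ∃ λ (M : Network c₀) → ∀ xs → ∀ i →
      f i (Vec.map (lookup xs) (wireColumn i)) ≡ List.map (lookup (⟦ M ⟧ xs)) (selected i)
    selectColumns =
      let M , ok = parallel columnJob [] (↭-trans (↭-reflexive (List.++-identityʳ _)) wireColumns-↭)
      in M , λ xs i → trans (proj₂ (f-net i) _) (sym (proj₁ (ok xs) i))

    module W = Wire.Merge k ns anti selected

    merging : Vec (Maybe (Fin c₀)) (∑ W.ks)
    merging = joinBlocks W.ks λ i → Wire.padPrefix (W.ls≤ks i) (selected i)

    catMaybes-merging : catMaybes (toList merging) ≡ List.concat (List.tabulate λ i → List.take (W.ls i) (selected i))
    catMaybes-merging = begin
      catMaybes (toList merging)
        ≡⟨ cong catMaybes (toList-joinBlocks W.ks _) ⟩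
      catMaybes (List.concat (List.tabulate λ i → toList (Wire.padPrefix (W.ls≤ks i) (selected i))))
        ≡⟨ catMaybes-concat (λ i → toList (Wire.padPrefix (W.ls≤ks i) (selected i))) ⟩
      List.concat (List.tabulate λ i → catMaybes (toList (Wire.padPrefix (W.ls≤ks i) (selected i))))
        ≡⟨ cong List.concat (List.tabulate-cong λ i →
             catMaybes-padPrefix Fin.≤-isTotalOrder m maxNet mw-merge (W.ls≤ks i) (selected i)) ⟩
      List.concat (List.tabulate λ i → List.take (W.ls i) (selected i)) ∎
      where open ≡-Reasoning

    -- Every wire occurs once: a selected list is its prefix, which goes to the merger, followed by
    -- its remainder in `out`, and padding occupies no wire. Hence dropping the ⊥s leaves exactly as
    -- many values as there were inputs.
    merging++out-↭ : catMaybes (toList merging) List.++ W.out ↭ allFin c₀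
    merging++out-↭ = begin
      catMaybes (toList merging) List.++ W.out
        ≡⟨ cong (List._++ W.out) catMaybes-merging ⟩
      List.concat (List.tabulate λ i → List.take (W.ls i) (selected i)) List.++ W.out
        ↭⟨ concat-tabulate-++ (λ i → List.take (W.ls i) (selected i)) (λ i → List.drop (W.ls i) (selected i)) ⟩
      List.concat (List.tabulate λ i → List.take (W.ls i) (selected i) List.++ List.drop (W.ls i) (selected i))
        ≡⟨ cong List.concat (List.tabulate-cong λ i → List.take++drop≡id (W.ls i) (selected i)) ⟩
      List.concat (List.tabulate selected)
        ↭⟨ concat-tabulate-↭ (λ i → Out↭In (columnJob i)) ⟩
      List.concat (List.tabulate (toList ∘ wireColumn))
        ↭⟨ wireColumns-↭ ⟩
      allFin c₀ ∎
      where open PermutationReasoning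

    splitNetwork : IsComparatorNetwork λ xs → Merge.output k ns anti λ i → f i (Columns.column ns anti xs i)
    splitNetwork =
      let M₁ , ok₁ = sortRows
          M₂ , ok₂ = selectColumns
          merged , merged↭ , run = ⊥-embed O (mw-merge (∑ W.ks) (W.ks (first m)) k) merging
          M₃ , ok₃ = run W.out merging++out-↭
          -- The output reads the cells left by the merger, skipping the empty ones, and then `out`.
          -- This order of wires is fixed before `xs` is known.
          N , ok = gather (M₁ ⨾ (M₂ ⨾ M₃)) (catMaybes (toList merged) List.++ W.out)
                     (↭-trans (↭.++⁺ʳ W.out merged↭) merging++out-↭)
      in N , λ xs →
        let s₂ = lookup (⟦ M₂ ⟧ (⟦ M₁ ⟧ xs))
            s₃ = lookup (⟦ M₃ ⟧ (⟦ M₂ ⟧ (⟦ M₁ ⟧ xs)))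
            z  = λ i → f i (Columns.column ns anti xs i)
            z≡ : ∀ i → z i ≡ List.map s₂ (selected i)
            z≡ i = trans (cong (f i) (ok₁ xs i)) (ok₂ (⟦ M₁ ⟧ xs) i)
            res≡ : Merge.res k ns anti z ≡ Vec.map (Maybe.map s₃) merged
            res≡ = trans
              (cong X₋.⟦ mw-merge (∑ W.ks) (W.ks (first m)) k ⟧ (trans
                (joinBlocks-cong W.ks λ i → trans (cong (padPrefix (W.ls≤ks i)) (z≡ i)) (sym (map-padPrefix (W.ls≤ks i) s₂ (selected i))))
                (sym (map-joinBlocks (Maybe.map s₂) W.ks _))))
              (sym (proj₁ (ok₃ (⟦ M₂ ⟧ (⟦ M₁ ⟧ xs)))))
            out≡ : Merge.out k ns anti z ≡ List.map s₃ W.out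
            out≡ = trans (trans
              (cong List.concat (trans
                (List.tabulate-cong λ i → trans (cong (List.drop (W.ls i)) (z≡ i)) (List.drop-map (W.ls i) (selected i)))
                (sym (List.map-tabulate _ (List.map s₂)))))
              (List.concat-map (List.tabulate λ i → List.drop (W.ls i) (selected i))))
              (sym (proj₂ (ok₃ (⟦ M₂ ⟧ (⟦ M₁ ⟧ xs)))))
        in begin
        catMaybes (toList (Merge.res k ns anti z)) List.++ Merge.out k ns anti z
          ≡⟨ cong₂ (λ v L → catMaybes (toList v) List.++ L) res≡ out≡ ⟩
        catMaybes (toList (Vec.map (Maybe.map s₃) merged)) List.++ List.map s₃ W.out
          ≡⟨ cong (λ L → catMaybes L List.++ List.map s₃ W.out) (Vec.toList-map (Maybe.map s₃) merged) ⟩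
        catMaybes (List.map (Maybe.map s₃) (toList merged)) List.++ List.map s₃ W.out
          ≡⟨ cong (List._++ List.map s₃ W.out) (List.map-catMaybes s₃ (toList merged)) ⟨
        List.map s₃ (catMaybes (toList merged)) List.++ List.map s₃ W.out
          ≡⟨ List.map-++ s₃ (catMaybes (toList merged)) W.out ⟨
        List.map s₃ (catMaybes (toList merged) List.++ W.out)
          ≡⟨ ok xs ⟩
        toList (⟦ N ⟧ xs) ∎
      where open ≡-Reasoning

  mw-sel-network : (splits : Splits m n k) → IsComparatorNetwork (mw-sel splits)
  mw-sel-network unchanged = idle , λ xs → cong toList (sym (⟦idle⟧ xs))
  mw-sel-network maximum   = maxNet _ , λ _ → refl
  mw-sel-network (split {k} _ ns anti _ subsplits) =
    SplitNetwork.splitNetwork k ns anti (λ i → mw-sel (subsplits i)) (λ i → mw-sel-network (subsplits i))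

-- Sums

∑-mono-≤ : {f g : Fin m → ℕ} → (∀ i → f i ≤ g i) → ∑ f ≤ ∑ g
∑-mono-≤ {m = zero}  f≤g = z≤n
∑-mono-≤ {m = suc m} f≤g = ℕ.+-mono-≤ (f≤g zero) (∑-mono-≤ (f≤g ∘ suc))

∑≤m*b : (f : Fin m → ℕ) (b : ℕ) → (∀ i → f i ≤ b) → ∑ f ≤ m * b
∑≤m*b {m = zero}  f b f≤b = z≤n
∑≤m*b {m = suc m} f b f≤b = ℕ.+-mono-≤ (f≤b zero) (∑≤m*b (f ∘ suc) b (f≤b ∘ suc))

sum-applyUpTo-∷ʳ : (g : ℕ → ℕ) (n : ℕ) → sum (applyUpTo g (suc n)) ≡ sum (applyUpTo g n) + g n
sum-applyUpTo-∷ʳ g n = begin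
  sum (applyUpTo g (suc n))                         ≡⟨ cong sum (List.applyUpTo-∷ʳ g n) ⟨
  sum (applyUpTo g n List.++ List.[ g n ])          ≡⟨ sum-++ (applyUpTo g n) List.[ g n ] ⟩
  sum (applyUpTo g n) + (g n + 0)                   ≡⟨ cong (sum (applyUpTo g n) +_) (ℕ.+-identityʳ (g n)) ⟩
  sum (applyUpTo g n) + g n                         ∎
  where open ≡-Reasoning

sum-applyUpTo≤∑ : (g : ℕ → ℕ) (f : Fin m → ℕ) → n ≤ m → (∀ i → toℕ i < n → g (toℕ i) ≤ f i) →
                  sum (applyUpTo g n) ≤ ∑ f
sum-applyUpTo≤∑ {n = zero}  g f n≤m       g≤f = z≤n
sum-applyUpTo≤∑ {n = suc n} g f (s≤s n≤m) g≤f =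
  ℕ.+-mono-≤ (g≤f zero (s≤s z≤n)) (sum-applyUpTo≤∑ (g ∘ suc) (f ∘ suc) n≤m λ i i<n → g≤f (suc i) (s≤s i<n))

sum-applyUpTo-≥ : (g : ℕ → ℕ) (b n : ℕ) → (∀ j → j < n → b ≤ g j) → n * b ≤ sum (applyUpTo g n)
sum-applyUpTo-≥ g b zero    b≤g = z≤n
sum-applyUpTo-≥ g b (suc n) b≤g = ℕ.+-mono-≤ (b≤g 0 (s≤s z≤n)) (sum-applyUpTo-≥ (g ∘ suc) b n λ j j<n → b≤g (suc j) (s≤s j<n))

m*n≤o⇒m≤o/n : ∀ {m n o} → m * suc n ≤ o → m ≤ o / suc n
m*n≤o⇒m≤o/n {m} {n} {o} mn≤o = ℕ.≤-trans (ℕ.≤-reflexive (sym (m*n/n≡m m (suc n)))) (/-monoˡ-≤ (suc n) mn≤o)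

m<n*[1+m/n] : ∀ m n → m < suc n * suc (m / suc n)
m<n*[1+m/n] m n = begin-strict
  m                                 ≡⟨ m≡m%n+[m/n]*n m (suc n) ⟩
  m % suc n + m / suc n * suc n     <⟨ ℕ.+-monoˡ-< _ (m%n<n m (suc n)) ⟩
  suc (m / suc n) * suc n           ≡⟨ ℕ.*-comm (suc (m / suc n)) (suc n) ⟩
  suc n * suc (m / suc n)           ∎
  where open ≤-Reasoning

-- At the first n with k < n b, the terms before the last are all equal to b,
-- and the last one is at least the remainder k − (n − 1) b.
k≤∑b⊓k/j : ∀ k b n → k < n * b → k ≤ sum (applyUpTo (λ j → b ⊓ (k / suc j)) n)
k≤∑b⊓k/j k b (suc n) k<[1+n]b with k ℕ.<? n * b
... | yes k<nb = begin
  k                                ≤⟨ k≤∑b⊓k/j k b n k<nb ⟩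
  sum (applyUpTo g n)              ≤⟨ ℕ.m≤m+n _ (g n) ⟩
  sum (applyUpTo g n) + g n        ≡⟨ sum-applyUpTo-∷ʳ g n ⟨
  sum (applyUpTo g (suc n))        ∎
  where
  open ≤-Reasoning
  g = λ j → b ⊓ (k / suc j)
... | no k≮nb = begin
  k                                ≡⟨ ℕ.m+[n∸m]≡n nb≤k ⟨
  n * b + rem                       ≤⟨ ℕ.+-mono-≤ (sum-applyUpTo-≥ g b n early) last ⟩
  sum (applyUpTo g n) + g n        ≡⟨ sum-applyUpTo-∷ʳ g n ⟨
  sum (applyUpTo g (suc n))        ∎
  where
  open ≤-Reasoning
  g = λ j → b ⊓ (k / suc j)
  nb≤k = ℕ.≮⇒≥ k≮nb
  rem = k ∸ n * b
  early : ∀ j → j < n → b ≤ g j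
  early j j<n = ℕ.⊓-glb ℕ.≤-refl (m*n≤o⇒m≤o/n (begin
    b * suc j  ≤⟨ ℕ.*-monoʳ-≤ b j<n ⟩
    b * n      ≡⟨ ℕ.*-comm b n ⟩
    n * b      ≤⟨ nb≤k ⟩
    k          ∎))
  r≤b : rem ≤ b
  r≤b = ℕ.m≤n+o⇒m∸n≤o k (n * b) (ℕ.≤-trans (ℕ.<⇒≤ k<[1+n]b) (ℕ.≤-reflexive (ℕ.+-comm b (n * b))))
  last : rem ≤ g n
  last = ℕ.⊓-glb r≤b (m*n≤o⇒m≤o/n (begin
    rem * suc n       ≡⟨ ℕ.*-suc rem n ⟩
    rem + rem * n      ≤⟨ ℕ.+-monoʳ-≤ rem (ℕ.*-monoˡ-≤ n r≤b) ⟩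
    rem + b * n       ≡⟨ cong (rem +_) (ℕ.*-comm b n) ⟩
    rem + n * b       ≡⟨ ℕ.m∸n+n≡m nb≤k ⟩
    k                ∎))

-- Counting

module _ {P : Pred A ℓᵖ} (P? : Decidable P) where

  count : List A → ℕ
  count xs = length (filter P? xs)

  count-++ : ∀ xs ys → count (xs List.++ ys) ≡ count xs + count ys
  count-++ xs ys = trans (cong length (List.filter-++ P? xs ys)) (List.length-++ (filter P? xs))

  count-accept : ∀ {x xs} → P x → count (x ∷ xs) ≡ suc (count xs)
  count-accept Px = cong length (List.filter-accept P? Px)

  count-none : ∀ {xs} → All (¬_ ∘ P) xs → count xs ≡ 0
  count-none none = cong length (List.filter-none P? none)

  count-all : ∀ {xs} → All P xs → count xs ≡ length xs
  count-all all = cong length (List.filter-all P? all)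

  count-↭ : ∀ {xs ys} → xs ↭ ys → count xs ≡ count ys
  count-↭ xs↭ys = ↭-length (↭.filter-↭ P? xs↭ys)

  length≤count⇒all : ∀ {xs} → length xs ≤ count xs → All P xs
  length≤count⇒all {xs} len≤ = subst (All P)
    (List.filter-complete P? (ℕ.≤-antisym (List.length-filter P? xs) len≤)) (All.all-filter P? xs)

  count-concat : (xss : Fin m → List A) → count (List.concat (List.tabulate xss)) ≡ ∑ (count ∘ xss)
  count-concat {m = zero}  xss = refl
  count-concat {m = suc m} xss = trans (count-++ (xss zero) _) (cong (count (xss zero) +_) (count-concat (xss ∘ suc)))

  count-take-≤ : ∀ k xs → count (List.take k xs) ≤ k ⊓ count xs
  count-take-≤ k xs = ℕ.⊓-glb
    (begin
      count (List.take k xs)   ≤⟨ List.length-filter P? (List.take k xs) ⟩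
      length (List.take k xs)  ≡⟨ List.length-take k xs ⟩
      k ⊓ length xs            ≤⟨ ℕ.m⊓n≤m k _ ⟩
      k                        ∎)
    (begin
      count (List.take k xs)                             ≤⟨ ℕ.m≤m+n _ _ ⟩
      count (List.take k xs) + count (List.drop k xs)    ≡⟨ count-++ (List.take k xs) (List.drop k xs) ⟨
      count (List.take k xs List.++ List.drop k xs)      ≡⟨ cong count (List.take++drop≡id k xs) ⟩
      count xs                                           ∎)
    where open ≤-Reasoning

  -- ⊥ never counts as large, so padding does not affect the counts.
  count-catMaybes : ∀ xs → length (filter (MaybeAny.dec P?) xs) ≡ count (catMaybes xs)
  count-catMaybes []             = refl
  count-catMaybes (nothing ∷ xs) = count-catMaybes xs
  count-catMaybes (just x ∷ xs) with P? x
  ... | yes _ = cong suc (count-catMaybes xs)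
  ... | no _  = count-catMaybes xs

-- Top k sorted sequences

take-++-length : (xs ys : List A) → List.take (length xs) (xs List.++ ys) ≡ xs
take-++-length []       ys = refl
take-++-length (x ∷ xs) ys = cong (x ∷_) (take-++-length xs ys)

lookup-++∈ˡ : (xs ys : List A) (i : Fin (length (xs List.++ ys))) → toℕ i < length xs → List.lookup (xs List.++ ys) i ∈ xs
lookup-++∈ˡ (x ∷ xs) ys zero    i<       = here refl
lookup-++∈ˡ (x ∷ xs) ys (suc i) (s≤s i<) = there (lookup-++∈ˡ xs ys i i<)

lookup-++∈ʳ : (xs ys : List A) (i : Fin (length (xs List.++ ys))) → length xs ≤ toℕ i → List.lookup (xs List.++ ys) i ∈ ys
lookup-++∈ʳ []       ys i       ≤i       = ∈.∈-lookup i
lookup-++∈ʳ (x ∷ xs) ys (suc i) (s≤s ≤i) = lookup-++∈ʳ xs ys i ≤i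

all-drop : {P : Pred A ℓᵖ} → ∀ k xs → (∀ j → k ≤ toℕ j → P (List.lookup xs j)) → All P (List.drop k xs)
all-drop zero    []       p = []
all-drop zero    (x ∷ xs) p = p zero z≤n ∷ all-drop zero xs λ j _ → p (suc j) z≤n
all-drop (suc k) []       p = []
all-drop (suc k) (x ∷ xs) p = all-drop k xs λ j k≤j → p (suc j) (s≤s k≤j)

module Top {A : Set a} {_≤ᴬ_ : Rel A ℓ} (O : IsTotalOrder _≡_ _≤ᴬ_) where
  open Ordered O

  _≥ᴬ_ : Rel A ℓ
  x ≥ᴬ y = y ≤ᴬ x

  _≤ᴬ?_ : ∀ x y → Dec (x ≤ᴬ y)
  x ≤ᴬ? y = DecTotalOrder._≤?_ ≥-decTotalOrder y x

  -- Large values are given by an up-closed predicate and not by a threshold, so that "every value",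
  -- and over `X ₋` "every value but ⊥", are covered too.
  UpClosed : Pred A ℓᵖ → Set _
  UpClosed P = ∀ {x y} → P x → x ≤ᴬ y → P y

  sorted⇒allPairs : ∀ {xs} → Sorted xs → AllPairs _≥ᴬ_ xs
  sorted⇒allPairs = Sorted.Sorted⇒AllPairs (DecTotalOrder.totalOrder ≥-decTotalOrder)

  allPairs⇒sorted : ∀ {xs} → AllPairs _≥ᴬ_ xs → Sorted xs
  allPairs⇒sorted = Sorted.AllPairs⇒Sorted (DecTotalOrder.totalOrder ≥-decTotalOrder)

  topSorted⁺ : ∀ {k} xs {ys} → length xs ≡ k → AllPairs _≥ᴬ_ xs → All (λ y → All (y ≤ᴬ_) xs) ys →
               TopSorted k (xs List.++ ys)
  topSorted⁺ xs {ys} refl xs↘ ys≤xs =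
      ℕ.≤-trans (ℕ.m≤m+n (length xs) (length ys)) (ℕ.≤-reflexive (sym (List.length-++ xs)))
    , subst Sorted (sym (take-++-length xs ys)) (allPairs⇒sorted xs↘)
    , λ i j i<k k≤j → All.lookup (All.lookup ys≤xs (lookup-++∈ʳ xs ys j k≤j)) (lookup-++∈ˡ xs ys i i<k)

  length-take-top : ∀ {k xs} → TopSorted k xs → length (List.take k xs) ≡ k
  length-take-top {k} {xs} (k≤ , _) = trans (List.length-take k xs) (ℕ.m≤n⇒m⊓n≡m k≤)

  drop≤take : ∀ {k xs} → TopSorted k xs → All (λ y → All (y ≤ᴬ_) (List.take k xs)) (List.drop k xs)
  drop≤take {k} {xs} (_ , _ , ≥rest) = go k xs ≥rest
    where
    go : ∀ k xs → (∀ i j → toℕ i < k → k ≤ toℕ j → List.lookup xs j ≤ᴬ List.lookup xs i) →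
         All (λ y → All (y ≤ᴬ_) (List.take k xs)) (List.drop k xs)
    go zero    xs       _     = All.universal (λ _ → []) xs
    go (suc k) []       _     = []
    go (suc k) (x ∷ xs) ≥rest = All.zipWith (λ (y≤x , y≤xs) → y≤x ∷ y≤xs)
      ( all-drop k xs (λ j k≤j → ≥rest zero (suc j) (s≤s z≤n) (s≤s k≤j))
      , go k xs (λ i j i<k k≤j → ≥rest (suc i) (suc j) (s≤s i<k) (s≤s k≤j)))

  module _ {P : Pred A ℓᵖ} (P? : Decidable P) (up : UpClosed P) where

    -- If the head is not large, then nothing is, as the head bounds all the rest. A large head is
    -- counted on both sides and removed.
    count-prefix : ∀ {xs ys} → AllPairs _≥ᴬ_ xs → All (λ y → All (y ≤ᴬ_) xs) ys →
                   length xs ⊓ count P? (xs List.++ ys) ≤ count P? xs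
    count-prefix {[]}     _            _     = z≤n
    count-prefix {x ∷ xs} {ys} (≤x ∷ xs↘) ys≤xs with P? x
    ... | yes Px = s≤s (count-prefix xs↘ (All.map All.tail ys≤xs))
    ... | no ¬Px = ℕ.≤-trans (ℕ.m⊓n≤n (suc (length xs)) _) (ℕ.≤-trans (ℕ.≤-reflexive
      (count-none P? (All.map (λ y≤x Py → ¬Px (up Py y≤x)) (All.++⁺ ≤x (All.map All.head ys≤xs))))) z≤n)

    count-take-≥ : ∀ {k xs} → TopSorted k xs → k ⊓ count P? xs ≤ count P? (List.take k xs)
    count-take-≥ {k} {xs} top = subst₂ (λ n ys → n ⊓ count P? ys ≤ count P? (List.take k xs))
      (length-take-top top) (List.take++drop≡id k xs)
      (count-prefix (sorted⇒allPairs (proj₁ (proj₂ top))) (drop≤take top))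

    top-all : ∀ {k xs} → TopSorted k xs → k ≤ count P? xs → All P (List.take k xs)
    top-all {k} {xs} top k≤ = length≤count⇒all P? (begin
      length (List.take k xs)     ≡⟨ length-take-top top ⟩
      k                           ≤⟨ ℕ.⊓-glb ℕ.≤-refl k≤ ⟩
      k ⊓ count P? xs             ≤⟨ count-take-≥ top ⟩
      count P? (List.take k xs)   ∎)
      where open ≤-Reasoning

    -- In a sorted vector the large entries form an initial segment. This and the converse
    -- `<count⇒lookup` translate between single entries and counts.
    lookup⇒<count : (xs : Vec A n) → AllPairs _≥ᴬ_ (toList xs) → ∀ i → P (lookup xs i) → toℕ i < count P? (toList xs)
    lookup⇒<count (x ∷ xs) (≤x ∷ xs↘) zero Px = ℕ.≤-trans (s≤s z≤n) (ℕ.≤-reflexive (sym (count-accept P? Px)))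
    lookup⇒<count (x ∷ xs) (≤x ∷ xs↘) (suc i) Pi = ℕ.≤-trans (s≤s (lookup⇒<count xs xs↘ i Pi))
      (ℕ.≤-reflexive (sym (count-accept P? (up Pi (All.lookup ≤x (lookup∈toList xs i))))))
      where
      lookup∈toList : ∀ {n} (xs : Vec A n) i → lookup xs i ∈ toList xs
      lookup∈toList (x ∷ xs) zero    = here refl
      lookup∈toList (x ∷ xs) (suc i) = there (lookup∈toList xs i)

    <count⇒lookup : (xs : Vec A n) → AllPairs _≥ᴬ_ (toList xs) → ∀ i → toℕ i < count P? (toList xs) → P (lookup xs i)
    <count⇒lookup (x ∷ xs) (≤x ∷ xs↘) i i< with P? x
    <count⇒lookup (x ∷ xs) (≤x ∷ xs↘) zero    i<       | yes Px = Px
    <count⇒lookup (x ∷ xs) (≤x ∷ xs↘) (suc i) (s≤s i<) | yes Px = <count⇒lookup xs xs↘ i i<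
    <count⇒lookup (x ∷ xs) (≤x ∷ xs↘) i       i<       | no ¬Px =
      contradiction (subst (toℕ i <_) (count-none P? (All.map (λ y≤x Py → ¬Px (up Py y≤x)) ≤x)) i<) λ ()

    count-mono : (xs : Vec A n) (ys : Vec A n′) → n ≤ n′ →
      (∀ i j → toℕ i ≡ toℕ j → lookup xs i ≤ᴬ lookup ys j) → count P? (toList xs) ≤ count P? (toList ys)
    count-mono []       ys       n≤n′       xs≤ys = z≤n
    count-mono (x ∷ xs) (y ∷ ys) (s≤s n≤n′) xs≤ys with P? x | P? y
    ... | yes Px | yes _  = s≤s (count-mono xs ys n≤n′ λ i j eq → xs≤ys (suc i) (suc j) (cong suc eq))
    ... | yes Px | no ¬Py = contradiction (up Px (xs≤ys zero zero refl)) ¬Py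
    ... | no _   | yes _  = ℕ.m≤n⇒m≤1+n (count-mono xs ys n≤n′ λ i j eq → xs≤ys (suc i) (suc j) (cong suc eq))
    ... | no _   | no _   = count-mono xs ys n≤n′ λ i j eq → xs≤ys (suc i) (suc j) (cong suc eq)

module _ {A : Set a} {_≤ᴬ_ : Rel A ℓ} (O : IsTotalOrder _≡_ _≤ᴬ_) where
  open Top O
  open IsTotalOrder O using () renaming (refl to ≤ᴬ-refl; trans to ≤ᴬ-trans)

  -- The entry at `j` serves as threshold: it is large, so `j`, and with it `i`, lies below the
  -- count.
  lookup-antitone : (xs : Vec A n) → AllPairs _≥ᴬ_ (toList xs) → ∀ {i j} → toℕ i ≤ toℕ j → lookup xs j ≤ᴬ lookup xs i
  lookup-antitone xs xs↘ {i} {j} i≤j = <count⇒lookup (lookup xs j ≤ᴬ?_) ≤ᴬ-trans xs xs↘ i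
    (ℕ.≤-<-trans i≤j (lookup⇒<count (lookup xs j ≤ᴬ?_) ≤ᴬ-trans xs xs↘ j ≤ᴬ-refl))

  any-upClosed : ∀ {P : Pred A ℓᵖ} → UpClosed P → Top.UpClosed (withBottom O) (MaybeAny.Any P)
  any-upClosed up (MaybeAny.just Px) [ x≤y ] = MaybeAny.just (up Px x≤y)

all-just⇒map-just : {P : Pred A ℓᵖ} {xs : List (Maybe A)} → All (MaybeAny.Any P) xs →
                     ∃ λ ys → xs ≡ List.map just ys × All P ys
all-just⇒map-just []              = [] , refl , []
all-just⇒map-just (MaybeAny.just Px ∷ pxs) = let ys , eq , pys = all-just⇒map-just pxs in
  _ ∷ ys , cong (just _ ∷_) eq , Px ∷ pys

catMaybes-map-just : (xs : List A) → catMaybes (List.map just xs) ≡ xs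
catMaybes-map-just []       = refl
catMaybes-map-just (x ∷ xs) = cong (x ∷_) (catMaybes-map-just xs)

toℕ-first : ∀ m .{{_ : NonTrivial m}} → toℕ (first m) ≡ 0
toℕ-first (2+ _) = refl

-- Top k sortedness of the selection

module _ {X : Set a} {_≤ˣ_ : Rel X ℓ} (O : IsTotalOrder _≡_ _≤ˣ_) (m : ℕ) .{{_ : NonTrivial m}}
  (maxNet : ∀ n → Network n) (mw-merge : ∀ s (c k : ℕ) → Network s) where
  open Ordered O
  open Wires O
  open Top O
  open Selection O m maxNet mw-merge
  open IsTotalOrder O using () renaming (trans to ≤ˣ-trans)
  private
    module X₋ = Ordered (withBottom O)
    module T₋ = Top (withBottom O)
    module W₋ = Wires (withBottom O)

  -- Both entries come from the same sorted row, and the later column is further to the right in it.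
  column-antitone : ∀ ns (anti : Antitone m ns) xs {i i′} → i Fin.≤ i′ → ∀ p q → toℕ p ≡ toℕ q →
                    lookup (Columns.column ns anti xs i′) p ≤ˣ lookup (Columns.column ns anti xs i) q
  column-antitone ns anti xs {i} {i′} i≤i′ p q p≡q =
    subst₂ _≤ˣ_ (sym (Vec.lookup∘tabulate _ p)) (sym (Vec.lookup∘tabulate _ q))
      (go (toℕ p) (toℕ q) p≡q (Fin.toℕ<n p) (Fin.toℕ<n q))
    where
    open Columns ns anti xs
    open Rows ns
    -- The row numbers are generalised from `toℕ p` and `toℕ q` so that their equality can be
    -- matched, which places both entries in one row.
    go : ∀ j j′ → j ≡ j′ → (j< : j < ns i′) (j′< : j′ < ns i) →
         lookup (sortᵛ (row j)) (fromℕ< (<rowLength⁺ i′ j<)) ≤ˣ lookup (sortᵛ (row j′)) (fromℕ< (<rowLength⁺ i j′<))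
    go j .j refl j< j′< = lookup-antitone O (sortᵛ (row j))
      (subst (AllPairs _≥ᴬ_) (sym (toList-sortᵛ (row j))) (sorted⇒allPairs (sort-↗ _)))
      (subst₂ _≤_ (sym (Fin.toℕ-fromℕ< (<rowLength⁺ i j′<))) (sym (Fin.toℕ-fromℕ< (<rowLength⁺ i′ j<))) i≤i′)

  module SplitSelects
    (merger : ∀ s c k → 1 ≤ k → k ≤ m * c → X₋.IsMerger m c k (mw-merge s c k))
    (k : ℕ) (1≤k : 1 ≤ k) (ns : Fin m → ℕ) (anti : Antitone m ns) (k≤n : k ≤ ∑ ns)
    (xs : Vec X (∑ ns)) (z : Fin m → List X)
    (z-↭ : ∀ i → z i ↭ toList (Columns.column ns anti xs i))
    (z-top : ∀ i → TopSorted (width (ns i) k i) (z i))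
    where
    open Merge k ns anti z

    z-length : ∀ i → length (z i) ≡ ns i
    z-length i = trans (↭-length (z-↭ i)) (Vec.length-toList (Columns.column ns anti xs i))

    -- Columns dominate later columns entry by entry. The lists `z` need not, but they are
    -- permutations of the columns, so the inequality between counts remains.
    z-count : {P : Pred X ℓᵖ} (P? : Decidable P) → UpClosed P → ∀ {i i′} → i Fin.≤ i′ → count P? (z i′) ≤ count P? (z i)
    z-count P? up {i} {i′} i≤i′ = subst₂ _≤_ (sym (count-↭ P? (z-↭ i′))) (sym (count-↭ P? (z-↭ i)))
      (count-mono P? up (Columns.column ns anti xs i′) (Columns.column ns anti xs i) (anti i≤i′) (column-antitone ns anti xs i≤i′))

    n₁ = ns (first m)

    pad : ∀ i → Vec (X ₋) (ks i)
    pad i = padPrefix (ls≤ks i) (z i)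

    catMaybes-padᵢ : ∀ i → catMaybes (toList (pad i)) ≡ List.take (ls i) (z i)
    catMaybes-padᵢ i = catMaybes-padPrefix O m maxNet mw-merge (ls≤ks i) (z i)

    pad-sorted : ∀ i → X₋.Sorted (toList (pad i))
    pad-sorted i = subst X₋.Sorted (sym (toList-padPrefix O m maxNet mw-merge (ls≤ks i) (z i))) (pad-↗ O (proj₁ (proj₂ (z-top i))) _)

    -- A ⊥ in `pad i′` is below everything. Otherwise that entry `x` is the threshold: `p` is below
    -- the count in prefix i′, hence below both `ls i′` and the count in `z i′`. Both bounds only
    -- grow in passing to `i`, and a top sorted list has as many large values in its prefix as fit.
    pad-dominates : ∀ {i i′} → i Fin.≤ i′ → ∀ p q → toℕ p ≡ toℕ q →
                    _≤₋_ _≤ˣ_ (lookup (pad i′) p) (lookup (pad i) q)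
    pad-dominates {i} {i′} i≤i′ p q p≡q with lookup (pad i′) p in eq
    ... | nothing = ⊥₋≤ _
    ... | just x  = from (T₋.<count⇒lookup P₋? (any-upClosed O ≤ˣ-trans) (pad i) (T₋.sorted⇒allPairs (pad-sorted i)) q (begin-strict
      toℕ q                                 ≡⟨ p≡q ⟨
      toℕ p                                 <⟨ T₋.lookup⇒<count P₋? (any-upClosed O ≤ˣ-trans) (pad i′) (T₋.sorted⇒allPairs (pad-sorted i′)) p
                                                 (subst (MaybeAny.Any (x ≤ˣ_)) (sym eq) (MaybeAny.just (IsTotalOrder.refl O))) ⟩
      count P₋? (toList (pad i′))           ≡⟨ trans (count-catMaybes (x ≤ᴬ?_) (toList (pad i′))) (cong (count (x ≤ᴬ?_)) (catMaybes-padᵢ i′)) ⟩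
      count (x ≤ᴬ?_) (List.take (ls i′) (z i′))  ≤⟨ count-take-≤ (x ≤ᴬ?_) (ls i′) (z i′) ⟩
      ls i′ ⊓ count (x ≤ᴬ?_) (z i′)         ≤⟨ ℕ.⊓-mono-≤ (ℕ.⊓-mono-≤ (anti i≤i′) (/-monoʳ-≤ k (s≤s i≤i′))) (z-count (x ≤ᴬ?_) ≤ˣ-trans i≤i′) ⟩
      ls i ⊓ count (x ≤ᴬ?_) (z i)           ≤⟨ count-take-≥ (x ≤ᴬ?_) ≤ˣ-trans (z-top i) ⟩
      count (x ≤ᴬ?_) (List.take (ls i) (z i))  ≡⟨ trans (count-catMaybes (x ≤ᴬ?_) (toList (pad i))) (cong (count (x ≤ᴬ?_)) (catMaybes-padᵢ i)) ⟨
      count P₋? (toList (pad i))            ∎))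
      where
      open ≤-Reasoning
      P₋? = MaybeAny.dec (x ≤ᴬ?_)
      from : ∀ {y} → MaybeAny.Any (x ≤ˣ_) y → _≤₋_ _≤ˣ_ (just x) y
      from (MaybeAny.just x≤y) = [ x≤y ]

    -- The merger is used with c = k₁, which may be smaller than n₁, but ⌊k/i⌋ ≤ k makes the lengths
    -- agree. The equality is not definitional, whence the casts in `res-top`.
    width-ks : ∀ i → ks i ≡ width (ks (first m)) k i
    width-ks i = begin
      n₁ ⊓ (k / suc (toℕ i))                                         ≡⟨ cong (n₁ ⊓_) (ℕ.m≥n⇒m⊓n≡n (/-monoʳ-≤ k (s≤s (first-≤ m i)))) ⟨
      n₁ ⊓ ((k / suc (toℕ (first m))) ⊓ (k / suc (toℕ i)))           ≡⟨ ℕ.⊓-assoc n₁ _ _ ⟨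
      width (ks (first m)) k i                                       ∎
      where open ≡-Reasoning

    -- The merger requires k/m ≤ c. Here c = min(n₁, k), and k is at most n, hence at most m times
    -- n₁, as well as at most m times k.
    k≤m*c : k ≤ m * ks (first m)
    k≤m*c = begin
      k                      ≤⟨ ℕ.⊓-glb (ℕ.≤-trans k≤n (∑≤m*b ns n₁ (λ i → anti (first-≤ m i)))) (ℕ.m≤n*m k m ⦃ nonTrivial⇒nonZero m ⦄) ⟩
      (m * n₁) ⊓ (m * k)     ≡⟨ ℕ.*-distribˡ-⊓ m n₁ k ⟨
      m * (n₁ ⊓ k)           ≡⟨ cong (λ x → m * (n₁ ⊓ x)) (n/1≡n k) ⟨
      m * (n₁ ⊓ (k / 1))     ≡⟨ cong (λ x → m * (n₁ ⊓ (k / suc x))) (toℕ-first m) ⟨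
      m * ks (first m)       ∎
      where open ≤-Reasoning

    res-top : X₋.TopSorted k (toList res)
    res-top = subst (λ v → X₋.TopSorted k (toList (X₋.⟦ mw-merge (∑ ks) (ks (first m)) k ⟧ v))) joined
      (merger (∑ ks) (ks (first m)) k 1≤k k≤m*c pad′ mwise eq)
      where
      pad′ : ∀ i → Vec (X ₋) (width (ks (first m)) k i)
      pad′ i = cast (width-ks i) (pad i)
      eq : ∑ {m} (width (ks (first m)) k) ≡ ∑ ks
      eq = Sum.sum-cong-≗ ℕ.+-0-commutativeMonoid (λ i → sym (width-ks i))
      joined : cast eq (joinBlocks (width (ks (first m)) k) pad′) ≡ joinBlocks ks pad
      joined = toList-injective (begin
        toList (cast eq (joinBlocks (width (ks (first m)) k) pad′))   ≡⟨ Vec.toList-cast eq _ ⟩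
        toList (joinBlocks (width (ks (first m)) k) pad′)             ≡⟨ toList-joinBlocks _ pad′ ⟩
        List.concat (List.tabulate (toList ∘ pad′))                   ≡⟨ cong List.concat (List.tabulate-cong λ i → Vec.toList-cast (width-ks i) (pad i)) ⟩
        List.concat (List.tabulate (toList ∘ pad))                    ≡⟨ toList-joinBlocks ks pad ⟨
        toList (joinBlocks ks pad)                                    ∎)
        where open ≡-Reasoning
      mwise : X₋.IsMWise (ks (first m)) k pad′
      mwise = record
        { sorted    = λ i → subst X₋.Sorted (sym (Vec.toList-cast (width-ks i) (pad i))) (pad-sorted i)
        ; dominates = λ i i′ i′≡1+i p q p≡q → subst₂ (_≤₋_ _≤ˣ_)
            (sym (Vec.lookup-cast₁ (width-ks i′) (pad i′) p)) (sym (Vec.lookup-cast₁ (width-ks i) (pad i) q))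
            (pad-dominates (ℕ.≤-trans (ℕ.n≤1+n _) (ℕ.≤-reflexive (sym i′≡1+i))) _ _
              (trans (Fin.toℕ-cast _ p) (trans p≡q (sym (Fin.toℕ-cast _ q)))))
        }

    count-res : {P : Pred X ℓᵖ} (P? : Decidable P) → UpClosed P →
                ∑ (λ i → ls i ⊓ count P? (z i)) ≤ count (MaybeAny.dec P?) (toList res)
    count-res P? up = begin
      ∑ (λ i → ls i ⊓ count P? (z i))                              ≤⟨ ∑-mono-≤ (λ i → count-take-≥ P? up (z-top i)) ⟩
      ∑ (λ i → count P? (List.take (ls i) (z i)))                  ≡⟨ Sum.sum-cong-≗ ℕ.+-0-commutativeMonoid (λ i → trans
                                                                        (count-catMaybes P? (toList (pad i))) (cong (count P?) (catMaybes-padᵢ i))) ⟨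
      ∑ (λ i → count (MaybeAny.dec P?) (toList (pad i)))              ≡⟨ count-concat (MaybeAny.dec P?) (toList ∘ pad) ⟨
      count (MaybeAny.dec P?) (List.concat (List.tabulate (toList ∘ pad))) ≡⟨ cong (count (MaybeAny.dec P?)) (toList-joinBlocks ks pad) ⟨
      count (MaybeAny.dec P?) (toList (joinBlocks ks pad))            ≡⟨ count-↭ (MaybeAny.dec P?) (W₋.⟦ mw-merge (∑ ks) (ks (first m)) k ⟧-↭ (joinBlocks ks pad)) ⟨
      count (MaybeAny.dec P?) (toList res)                            ∎
      where open ≤-Reasoning

    -- More than ⌊k/i⌋ large values in column i force as many in every earlier column.
    k≤count-res : {P : Pred X ℓᵖ} (P? : Decidable P) → UpClosed P → ∀ i → k / suc (toℕ i) < count P? (z i) →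
                  k ≤ count (MaybeAny.dec P?) (toList res)
    k≤count-res P? up i q<count = begin
      k                                            ≤⟨ k≤∑b⊓k/j k b (suc (toℕ i)) (m<n*[1+m/n] k (toℕ i)) ⟩
      _                                            ≤⟨ sum-applyUpTo≤∑ (λ j → b ⊓ (k / suc j)) (λ i → ls i ⊓ count P? (z i)) (Fin.toℕ<n i) bound ⟩
      ∑ (λ i → ls i ⊓ count P? (z i))              ≤⟨ count-res P? up ⟩
      count (MaybeAny.dec P?) (toList res)            ∎
      where
      open ≤-Reasoning
      b = suc (k / suc (toℕ i))
      bound : ∀ i′ → toℕ i′ < suc (toℕ i) → b ⊓ (k / suc (toℕ i′)) ≤ ls i′ ⊓ count P? (z i′)
      bound i′ i′<1+i = ℕ.⊓-glb
        (ℕ.⊓-monoˡ-≤ (k / suc (toℕ i′)) (ℕ.≤-trans b≤count (ℕ.≤-trans (List.length-filter P? (z i′)) (ℕ.≤-reflexive (z-length i′)))))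
        (ℕ.≤-trans (ℕ.m⊓n≤m b _) b≤count)
        where
        b≤count : b ≤ count P? (z i′)
        b≤count = ℕ.≤-trans q<count (z-count P? up (s≤s⁻¹ i′<1+i))

    always? : Decidable {A = X} (λ _ → ⊤)
    always? _ = yes tt

    count-always : ∀ i → count always? (z i) ≡ ns i
    count-always i = trans (count-all always? (All.universal (λ _ → tt) (z i))) (z-length i)

    -- If some column is longer than ⌊k/i⌋, the count from that column applies with every value
    -- large. Otherwise lᵢ = nᵢ throughout, so all n ≥ k values enter the merger.
    k≤non-⊥ : k ≤ count (MaybeAny.dec always?) (toList res)
    k≤non-⊥ with Fin.any? (λ i → k / suc (toℕ i) ℕ.<? ns i)
    ... | yes (i , q<nᵢ) = k≤count-res always? _ i (subst (_ <_) (sym (count-always i)) q<nᵢ)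
    ... | no none = begin
      k                                           ≤⟨ k≤n ⟩
      ∑ ns                                        ≤⟨ ∑-mono-≤ (λ i → ℕ.⊓-glb
                                                       (ℕ.⊓-glb ℕ.≤-refl (ℕ.≮⇒≥ λ q<nᵢ → none (i , q<nᵢ)))
                                                       (ℕ.≤-reflexive (sym (count-always i)))) ⟩
      ∑ (λ i → ls i ⊓ count always? (z i))        ≤⟨ count-res always? _ ⟩
      count (MaybeAny.dec always?) (toList res)      ∎
      where open ≤-Reasoning

    -- All lᵢ = ⌊k/i⌋ selected values of its column are at least `w`, and `w` itself is one more.
    k≤count-≥out : ∀ {w} → w ∈ out → k ≤ count (MaybeAny.dec (w ≤ᴬ?_)) (toList res)
    k≤count-≥out {w} w∈out with ∈.∈-concat⁻′ (List.tabulate λ i → List.drop (ls i) (z i)) w∈out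
    ... | L , w∈L , L∈ with ∈.∈-tabulate⁻ L∈
    ... | i , refl = k≤count-res (w ≤ᴬ?_) ≤ˣ-trans i (begin-strict
      k / suc (toℕ i)                                      ≡⟨ ls≡ ⟨
      ls i                                                 ≡⟨ length-take-top (z-top i) ⟨
      length (List.take (ls i) (z i))                      ≡⟨ count-all (w ≤ᴬ?_) (All.lookup (drop≤take (z-top i)) w∈L) ⟨
      count (w ≤ᴬ?_) (List.take (ls i) (z i))              <⟨ ℕ.m<m+n _ (List.filter-some (w ≤ᴬ?_) (lose w∈L (IsTotalOrder.refl O))) ⟩
      count (w ≤ᴬ?_) (List.take (ls i) (z i)) + count (w ≤ᴬ?_) (List.drop (ls i) (z i)) ≡⟨ count-++ (w ≤ᴬ?_) (List.take (ls i) (z i)) _ ⟨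
      count (w ≤ᴬ?_) (List.take (ls i) (z i) List.++ List.drop (ls i) (z i)) ≡⟨ cong (count (w ≤ᴬ?_)) (List.take++drop≡id (ls i) (z i)) ⟩
      count (w ≤ᴬ?_) (z i)                                 ∎)
      where
      open ≤-Reasoning
      ls≡ : ls i ≡ k / suc (toℕ i)
      ls≡ with ℕ.⊓-sel (ns i) (k / suc (toℕ i))
      ... | inj₂ eq = eq
      -- With lᵢ = nᵢ the prefix is the whole column and leaves out no `w`.
      ... | inj₁ eq = contradiction (subst (w ∈_) (List.drop-all (ls i) (z i) (ℕ.≤-reflexive (trans (z-length i) (sym eq)))) w∈L) λ ()

    -- As the first `k` entries of `res` are not ⊥, dropping ⊥ keeps them in place as `ys`. The
    -- other entries of `res` are below them by the merger's guarantee, and each left-out `w` by the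
    -- count with `w` as threshold.
    output-top : TopSorted k output
    output-top with all-just⇒map-just (T₋.top-all (MaybeAny.dec always?) (any-upClosed O {P = λ _ → ⊤} _) res-top k≤non-⊥)
    ... | ys , take≡ , _ = subst (TopSorted k) output≡ (topSorted⁺ ys length-ys ys↘
        (All.++⁺ (non-⊥ (List.drop k (toList res)) (T₋.drop≤take res-top)) (All.tabulate out≤ys)))
      where
      length-ys : length ys ≡ k
      length-ys = trans (sym (List.length-map just ys)) (trans (cong length (sym take≡)) (T₋.length-take-top res-top))
      ys↘ : AllPairs _≥ᴬ_ ys
      ys↘ = AllPairs.map ([≤]-injective _) (AllPairs.map⁻ (subst (AllPairs T₋._≥ᴬ_) take≡ (T₋.sorted⇒allPairs (proj₁ (proj₂ res-top)))))
      non-⊥ : ∀ qs → All (λ q → All (_≤₋_ _≤ˣ_ q) (List.take k (toList res))) qs → All (λ y → All (y ≤ˣ_) ys) (catMaybes qs)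
      non-⊥ []             []         = []
      non-⊥ (nothing ∷ qs) (_ ∷ ≤qs)  = non-⊥ qs ≤qs
      non-⊥ (just y ∷ qs)  (≤y ∷ ≤qs) = All.map ([≤]-injective _) (All.map⁻ (subst (All _) take≡ ≤y)) ∷ non-⊥ qs ≤qs
      out≤ys : ∀ {w} → w ∈ out → All (w ≤ˣ_) ys
      out≤ys {w} w∈out = All.map MaybeAny.drop-just (All.map⁻ (subst (All _) take≡
        (T₋.top-all (MaybeAny.dec (w ≤ᴬ?_)) (any-upClosed O ≤ˣ-trans) res-top (k≤count-≥out w∈out))))
      output≡ : ys List.++ catMaybes (List.drop k (toList res)) List.++ out ≡ output
      output≡ = begin
        ys List.++ catMaybes (List.drop k (toList res)) List.++ out
          ≡⟨ List.++-assoc ys _ _ ⟨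
        (ys List.++ catMaybes (List.drop k (toList res))) List.++ out
          ≡⟨ cong (λ L → (L List.++ catMaybes (List.drop k (toList res))) List.++ out) (trans (cong catMaybes take≡) (catMaybes-map-just ys)) ⟨
        (catMaybes (List.take k (toList res)) List.++ catMaybes (List.drop k (toList res))) List.++ out
          ≡⟨ cong (List._++ out) (List.catMaybes-++ (List.take k (toList res)) _) ⟨
        catMaybes (List.take k (toList res) List.++ List.drop k (toList res)) List.++ out
          ≡⟨ cong (λ L → catMaybes L List.++ out) (List.take++drop≡id k (toList res)) ⟩
        output ∎
        where open ≡-Reasoning

  max-top : (N : Network n) → IsMaxNetwork N → 1 ≤ n → ∀ xs → TopSorted 1 (toList (⟦ N ⟧ xs))
  max-top {suc n} N isMax _ xs with ⟦ N ⟧ xs | ⟦ N ⟧-↭ xs | isMax xs zero refl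
  ... | y ∷ ys | y∷ys↭xs | _ , xs≤y = topSorted⁺ List.[ y ] refl ([] ∷ [])
    (All.map (_∷ []) (All.tail (↭.All-resp-↭ (↭-sym y∷ys↭xs) (VecAll.toList⁺ xs≤y))))

  module _
    (isMax : ∀ n → IsMaxNetwork (maxNet n))
    (merger : ∀ s c k → 1 ≤ k → k ≤ m * c → X₋.IsMerger m c k (mw-merge s c k))
    where

    -- The claim includes k = 0, which the recursion meets in columns with lᵢ = 0. That recursive
    -- results permute their columns is taken from their networks.
    mw-sel-top : (splits : Splits m n k) → k ≤ n → ∀ xs → TopSorted k (mw-sel splits xs)
    mw-sel-top unchanged _   xs = z≤n , [] , λ _ _ ()
    mw-sel-top maximum   1≤n xs = max-top (maxNet _) (isMax _) 1≤n xs
    mw-sel-top (split {k} 2≤k ns anti _ subsplits) k≤n xs =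
      SplitSelects.output-top merger k (ℕ.<⇒≤ 2≤k) ns anti k≤n xs _
        (λ i → let N , eq = mw-sel-network O m maxNet mw-merge (subsplits i) in
          ↭-trans (↭-reflexive (eq _)) (⟦ N ⟧-↭ _))
        (λ i → mw-sel-top (subsplits i) (ℕ.m⊓n≤m (ns i) _) _)

mainTheorem3 : ∀ {a ℓ} {X : Set a} {_≤ˣ_ : Rel X ℓ} (O : IsTotalOrder _≡_ _≤ˣ_)
    (m : ℕ) .{{_ : NonTrivial m}}
    (maxNet : ∀ n → Network n) (mw-merge : ∀ s (c k : ℕ) → Network s) →
    (∀ n → Ordered.IsMaxNetwork O (maxNet n)) →
    (∀ s c k → 1 ≤ k → k ≤ m * c → Ordered.IsMerger (withBottom O) m c k (mw-merge s c k)) →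
    ∀ n k → 1 ≤ k → k ≤ n → (splits : Splits m n k) →
    Ordered.IsSelectionNetwork O k (Selection.mw-sel O m maxNet mw-merge splits)
mainTheorem3 O m maxNet mw-merge isMax merger n k _ k≤n splits =
  mw-sel-network O m maxNet mw-merge splits , mw-sel-top O m maxNet mw-merge isMax merger splits k≤n
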